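{- Let $n\geq 1$ and $k\geq 2$ be integers, let $r$ be a positive integer with $r\leq \frac{(k-1)(2n)}{k}$, and let $\mathcal{F}\subseteq \mathscr{P}^r(M_n)$ be $k$-wise intersecting. Then $$|\mathcal{F}| \leq \begin{cases} 2^{r-1}\binom{n-1}{r-1} & \text{if } r\leq n,\\[2pt] 2^{2n-r}\binom{n-1}{2n-r}+2^{2n-r-1}\binom{n-1}{2n-r-1} & \text{otherwise.}\end{cases}$$ Moreover, if $r<\frac{(k-1)(2n)}{k}$, then equality holds if and only if $\mathcal{F}=\mathscr{P}^r_x(M_n)$ for some $x\in V(M_n)$.
   Context: $M_n$ denotes the perfect matching graph on $2n$ vertices, i.e. the graph with $2n$ vertices and $n$ pairwise disjoint edges. For a graph $G$, let $\alpha(G)$ be its independence number (the size of a maximum independent set). Let $\mathscr{I}(G)$ be the family of all independent vertex sets of $G$, let $\mathscr{M}(G)$ be the family of all vertex sets of $G$ that contain an independent set of size $\alpha(G)$, and let $\mathscr{P}(G)=\mathscr{I}(G)\cup\mathscr{M}(G)$. For a positive integer $r$, $\mathscr{P}^r(G)=\{A\in\mathscr{P}(G): |A|=r\}$, and for a vertex $x\in V(G)$, $\mathscr{P}^r_x(G)=\{A\in \mathscr{P}^r(G): x\in A\}$. A family $\mathcal{F}$ of sets is $k$-wise intersecting if for any $F_1,\ldots,F_k\in\mathcal{F}$ (not necessarily distinct) one has $\bigcap_{i=1}^k F_i\neq\emptyset$. As usual $\binom{a}{b}=0$ when $b>a\ge 0$. -}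

module Defs where

open import Level using (0ℓ)
open import Data.Bool using (if_then_else_)
open import Data.Nat using (ℕ; _+_; _*_; _∸_; _^_; _≤_; _≤?_)
open import Data.Nat.Combinatorics using (_C_)
open import Data.Fin using (Fin; remainder)
open import Data.Fin.Subset using (Subset; _∈_; _⊆_; ∣_∣; ⋂; Nonempty)
open import Data.List using (List; tabulate)
import Data.List.Membership.Propositional as List
open import Data.Product using (_×_; _,_; ∃-syntax)
open import Relation.Nullary using (¬_; does)
open import Relation.Unary using (Pred; _∪_)
open import Relation.Binary using (Rel; Symmetric; Irreflexive)
open import Relation.Binary.PropositionalEquality using (_≡_; _≢_; sym)

record Graph (m : ℕ) : Set₁ where
  field
    Adj        : Rel (Fin m) 0ℓ
    Adj-sym    : Symmetric Adj
    Adj-irrefl : Irreflexive _≡_ Adj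

-- Under  remainder n  the vertices 0 … 2n-1 are reduced modulo n, so the edges
-- are exactly the n disjoint pairs {i , n + i} with 0 ≤ i < n.
M : (n : ℕ) → Graph (2 * n)
M n = record
  { Adj        = λ u v → u ≢ v × remainder {2} n u ≡ remainder {2} n v
  ; Adj-sym    = λ { (u≢v , eq) → (λ v≡u → u≢v (sym v≡u)) , sym eq }
  ; Adj-irrefl = λ { u≡v (u≢v , _) → u≢v u≡v }
  }

module _ {m : ℕ} (G : Graph m) where
  open Graph G

  Independent : Pred (Subset m) 0ℓ
  Independent S = ∀ {u v} → u ∈ S → v ∈ S → ¬ Adj u v

  -- The relation "α(G) = a".
  IndependenceNumber : Pred ℕ 0ℓ
  IndependenceNumber a =
    (∃[ S ] Independent S × ∣ S ∣ ≡ a) × (∀ S → Independent S → ∣ S ∣ ≤ a)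

  ContainsMaximum : Pred (Subset m) 0ℓ
  ContainsMaximum A =
    ∃[ a ] IndependenceNumber a × ∃[ S ] (S ⊆ A × Independent S × ∣ S ∣ ≡ a)

  𝓟 : Pred (Subset m) 0ℓ
  𝓟 = Independent ∪ ContainsMaximum

  𝓟^ : ℕ → Pred (Subset m) 0ℓ
  𝓟^ r A = 𝓟 A × ∣ A ∣ ≡ r

  𝓟^-at : ℕ → Fin m → Pred (Subset m) 0ℓ
  𝓟^-at r x A = 𝓟^ r A × x ∈ A

-- Finite families of sets are lists; they are used together with a
-- hypothesis that the list has no repetitions, so that its length is |F|.
Family : ℕ → Set
Family m = List (Subset m)

_∈ᶠ_ : ∀ {m} → Subset m → Family m → Set
A ∈ᶠ F = A List.∈ F

WiseIntersecting : ∀ {m} → ℕ → Family m → Set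
WiseIntersecting {m} k F =
  (A : Fin k → Subset m) → (∀ i → A i ∈ᶠ F) → Nonempty (⋂ (tabulate A))

-- When  r * k ≤ (k ∸ 1) * (2 * n)  with n , r , k ≥ 1 we have 1 ≤ r < 2n, so none
-- of the subtractions below is truncated.
bound : ℕ → ℕ → ℕ
bound n r =
  if does (r ≤? n)
  then 2 ^ (r ∸ 1) * ((n ∸ 1) C (r ∸ 1))
  else 2 ^ (2 * n ∸ r) * ((n ∸ 1) C (2 * n ∸ r))
     + 2 ^ (2 * n ∸ r ∸ 1) * ((n ∸ 1) C (2 * n ∸ r ∸ 1))

{-# OPTIONS --safe #-}
module Submission where

-- Katona's circle method. Place the 2n vertices on a cycle so that the two ends of every
-- edge are antipodal; then all arcs of length r belong to 𝓟^r. If F is k-wise intersecting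
-- and r k ≤ (k - 1) 2n, then at most r of the 2n arcs are in F: with s = 2n - r, collapsing
-- a cycle of length k s onto the cycle of length 2n turns every residue class modulo s into
-- k starting points whose arcs have no common point, so each of the s classes is missed
-- by F somewhere. Signed permutations act transitively on 𝓟^r, so averaging over all
-- arrangements gives |F| ≤ r |𝓟^r| / 2n, which is the bound.
--
-- In case of equality every arrangement has exactly r arcs in F, and if the inequality for r
-- is strict, moving one of the extra points of the collapse shows that these are the arcs
-- through one point x. The strict inequality leaves room for k - 1 of these arcs and any arc
-- that avoids x after an adjacent swap to have no common point, so x remains the centre under
-- all permutations of the other positions. If r ≤ n these arrangements exhibit every member of
-- 𝓟^r through x as an arc, hence F contains the star of x; if r > n they exhibit every member
-- of 𝓟^r avoiding x, hence F is contained in the star. Either way F is the star.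

open import Defs
open import Data.Bool using (Bool; true; false; not; if_then_else_)
import Data.Bool.Properties as Bool
open import Data.Bool.Properties using (not-involutive)
open import Data.Empty using (⊥; ⊥-elim)
open import Data.Fin using (Fin; zero; suc; toℕ; fromℕ<; combine; quotient; remainder; remQuot; opposite)
open import Data.Fin.Properties
  using (toℕ<n; toℕ-fromℕ<; remQuot-combine; combine-remQuot; combine-surjective; opposite-involutive; nonZeroIndex)
  renaming (_≟_ to _≟ᶠ_)
open import Data.Fin.Subset using (Subset; _∈_; _∉_; _⊆_; ∣_∣; ⋂; ∁; ⁅_⁆; _∪_) renaming (⊥ to ∅)
open import Data.Fin.Subset.Properties
  using (_∈?_; ⊆-antisym; ⊆-reflexive; ∉⊥; ∣⊥∣≡0; ∪-identityˡ; x∈⁅x⁆; x∈⁅y⁆⇒x≡y; x∈p∪q⁺; x∈p∪q⁻; p∩q⊆p; p∩q⊆q;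
         p⊂q⇒∣p∣<∣q∣; x∈p⇒x∉∁p; x∈∁p⇒x∉p; x∉p⇒x∈∁p; ∣∁p∣≡n∸∣p∣; nonempty?; Empty-unique)
open import Data.List
  using (List; []; _∷_; _∷ʳ_; [_]; _++_; length; map; applyUpTo; allFin; tabulate; filter; cartesianProductWith)
open import Data.List.Properties
  using (length-++; length-map; length-applyUpTo; length-tabulate; map-++; map-∘; map-cong; map-id; map-injective;
         ++-assoc; ++-identityʳ; ∷-injective)
import Data.List.Membership.DecPropositional as DecMembership
open import Data.List.Membership.Propositional using () renaming (_∈_ to _∈ₗ_)
open import Data.List.Membership.Propositional.Properties
  using (∈-∃++; ∈-++⁺ˡ; ∈-++⁺ʳ; ∈-++⁻; ∈-map⁺; ∈-map⁻; ∈-filter⁺; ∈-filter⁻; ∈-applyUpTo⁺; ∈-applyUpTo⁻; ∈-allFin;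
         ∈-length; ∈-cartesianProductWith⁺)
open import Data.List.Membership.Propositional.Properties.WithK using (unique∧set⇒bag)
open import Data.List.Relation.Binary.BagAndSetEquality using (∼bag⇒↭)
open import Data.List.Relation.Binary.Permutation.Propositional as ↭
  using (_↭_; refl; prep; swap; ↭-sym; ↭-trans; ↭⇒↭ₛ)
open import Data.List.Relation.Binary.Permutation.Propositional.Properties
  using (shift; ++⁺ˡ; ∷↭∷ʳ; ↭-length) renaming (++-comm to ↭-++-comm; map⁺ to ↭-map⁺)
open import Data.List.Relation.Binary.Permutation.Setoid.Properties using (AllPairs-resp-↭)
open import Data.List.Relation.Unary.All as All using (All; []; _∷_)
open import Data.List.Relation.Unary.All.Properties using (All¬⇒¬Any)
open import Data.List.Relation.Unary.AllPairs as AllPairs using (AllPairs; []; _∷_; allPairs?)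
import Data.List.Relation.Unary.AllPairs.Properties as AllPairs
open import Data.List.Relation.Unary.Any using (here; there)
open import Data.List.Relation.Unary.Unique.Propositional using (Unique)
import Data.List.Relation.Unary.Unique.Propositional.Properties as Unique
open import Data.Maybe using (Maybe; just; nothing)
open import Data.Nat
open import Data.Nat.Combinatorics using (_C_; nCk+nC[k+1]≡[n+1]C[k+1]; k>n⇒nCk≡0; nCk≡nC[n∸k]; nCn≡1)
open import Data.Nat.DivMod using (m≡m%n+[m/n]*n; m%n<n; _%_; _/_)
open import Data.Nat.ListAction using (sum)
open import Data.Nat.ListAction.Properties using (sum-↭)
open import Data.Nat.Properties
open import Data.Nat.Solver using (module +-*-Solver)
open import Data.Product using (_×_; _,_; ∃-syntax; proj₁; proj₂; map₂)
open import Data.Sum using (_⊎_; inj₁; inj₂; [_,_]′)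
open import Data.Vec as Vec using (Vec; []; _∷_; lookup)
open import Data.Vec.Properties as Vec using (≡-dec; lookup-++ˡ; lookup-++ʳ; take++drop≡id; []=⇒lookup; lookup⇒[]=)
open import Function using (_∘_; id; mk⇔)
open import Function.Bundles using (_⇔_)
open import Relation.Binary using (tri<; tri≈; tri>)
open import Relation.Binary.PropositionalEquality
  using (_≡_; _≢_; refl; sym; trans; cong; cong₂; subst; setoid; module ≡-Reasoning)
open import Relation.Nullary using (¬_; Dec; yes; no; does)
open import Relation.Nullary.Decidable using (dec-true; dec-false; does-⇔; _×-dec_; _⊎-dec_; ¬?)
open import Relation.Nullary.Negation using (contradiction)
open import Relation.Unary using (Decidable; _≐_)

-- Arcs on a cycle

-- Write k s = 2n + t. The hypothesis r k ≤ (k - 1) 2n says exactly that t ≥ 0, and its strict form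
-- that t ≥ 1. For t = 0 a residue class modulo s cuts the cycle itself into k arcs. For t > 0 the t
-- extra points are stacked on a starting point whose arc is in F, where they never count as missed.
-- The uniqueness argument needs one extra point that can be moved elsewhere, hence t ≥ 1. The
-- obstacle at the end is that reordering the letters behind x never turns an edge round relative to
-- x. An arc that meets both halves of such an arrangement passes through x or its antipode, so an
-- independent set that avoids the edge of x need not occur as an arc at all. Hence only one
-- inclusion between F and the star of x is read off from these arrangements. The other comes from
-- counting: F and the star both have exactly r arcs on every arrangement.

Σ< : ℕ → (ℕ → ℕ) → ℕ
Σ< n f = sum (applyUpTo f n)

Σ<-cong : ∀ n {f g} → (∀ i → i < n → f i ≡ g i) → Σ< n f ≡ Σ< n g
Σ<-cong zero    _   = refl
Σ<-cong (suc n) f≡g = cong₂ _+_ (f≡g 0 z<s) (Σ<-cong n λ i i<n → f≡g (suc i) (s<s i<n))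

Σ<-mono : ∀ n {f g} → (∀ i → i < n → f i ≤ g i) → Σ< n f ≤ Σ< n g
Σ<-mono zero    _   = z≤n
Σ<-mono (suc n) f≤g = +-mono-≤ (f≤g 0 z<s) (Σ<-mono n λ i i<n → f≤g (suc i) (s<s i<n))

Σ<-const : ∀ n c → Σ< n (λ _ → c) ≡ n * c
Σ<-const zero    _ = refl
Σ<-const (suc n) c = cong (c +_) (Σ<-const n c)

Σ<-split : ∀ m n f → Σ< (m + n) f ≡ Σ< m f + Σ< n (λ i → f (m + i))
Σ<-split zero    n f = refl
Σ<-split (suc m) n f =
  trans (cong (f 0 +_) (Σ<-split m n (f ∘ suc))) (sym (+-assoc (f 0) _ _))

Σ<-+ : ∀ n f g → Σ< n (λ i → f i + g i) ≡ Σ< n f + Σ< n g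
Σ<-+ zero    f g = refl
Σ<-+ (suc n) f g = trans (cong (f 0 + g 0 +_) (Σ<-+ n (f ∘ suc) (g ∘ suc)))
  (solve 4 (λ a b c d → a :+ b :+ (c :+ d) := a :+ c :+ (b :+ d)) refl (f 0) (g 0) _ _)
  where open +-*-Solver

-- Every position below `k * s` is `c + i * s` for one residue c and one i; the induction peels off
-- the first block of s terms.
Σ<-classes : ∀ k s f → Σ< (k * s) f ≡ Σ< s (λ c → Σ< k (λ i → f (c + i * s)))
Σ<-classes zero    s f = sym (trans (Σ<-const s 0) (*-zeroʳ s))
Σ<-classes (suc k) s f = begin
  Σ< (s + k * s) f
    ≡⟨ Σ<-split s (k * s) f ⟩
  Σ< s f + Σ< (k * s) (λ j → f (s + j))
    ≡⟨ cong₂ _+_ (Σ<-cong s λ c _ → cong f (sym (+-identityʳ c))) (Σ<-classes k s (λ j → f (s + j))) ⟩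
  Σ< s (λ c → f (c + 0)) + Σ< s (λ c → Σ< k (λ i → f (s + (c + i * s))))
    ≡⟨ Σ<-+ s _ _ ⟨
  Σ< s (λ c → f (c + 0) + Σ< k (λ i → f (s + (c + i * s))))
    ≡⟨ Σ<-cong s (λ c _ → cong (f (c + 0) +_) (Σ<-cong k λ i _ → cong f (reassoc c (i * s)))) ⟩
  Σ< s (λ c → f (c + 0) + Σ< k (λ i → f (c + (s + i * s)))) ∎
  where
  open ≡-Reasoning
  reassoc : ∀ c j → s + (c + j) ≡ c + (s + j)
  reassoc c j = trans (sym (+-assoc s c j)) (trans (cong (_+ j) (+-comm s c)) (+-assoc c s j))

Σ<-term : ∀ n f i → i < n → f i ≤ Σ< n f
Σ<-term (suc n) f zero    _         = m≤m+n (f 0) _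
Σ<-term (suc n) f (suc i) (s<s i<n) = ≤-trans (Σ<-term n (f ∘ suc) i i<n) (m≤n+m _ (f 0))

Σ<-two-terms : ∀ n f i j → i < j → j < n → f i + f j ≤ Σ< n f
Σ<-two-terms (suc n) f zero    (suc j) _         (s<s j<n) = +-monoʳ-≤ (f 0) (Σ<-term n (f ∘ suc) j j<n)
Σ<-two-terms (suc n) f (suc i) (suc j) (s<s i<j) (s<s j<n) =
  ≤-trans (Σ<-two-terms n (f ∘ suc) i j i<j j<n) (m≤n+m _ (f 0))

+-squeeze : ∀ {a b c d} → a ≤ c → b ≤ d → a + b ≡ c + d → a ≡ c × b ≡ d
+-squeeze {a} {b} {c} {d} a≤c b≤d eq with m≤n⇒m<n∨m≡n a≤c
... | inj₁ a<c  = contradiction eq (<⇒≢ (+-mono-<-≤ a<c b≤d))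
... | inj₂ refl = refl , +-cancelˡ-≡ a b d eq

-- The source of the equality cases on a single cycle: once the totals agree, no term has any slack.
Σ<-squeeze : ∀ n {f g} → (∀ i → i < n → f i ≤ g i) → Σ< n f ≡ Σ< n g → ∀ i → i < n → f i ≡ g i
Σ<-squeeze (suc n) f≤g eq zero _ =
  proj₁ (+-squeeze (f≤g 0 z<s) (Σ<-mono n λ i i<n → f≤g (suc i) (s<s i<n)) eq)
Σ<-squeeze (suc n) f≤g eq (suc i) (s<s i<n) =
  Σ<-squeeze n (λ i i<n → f≤g (suc i) (s<s i<n))
    (proj₂ (+-squeeze (f≤g 0 z<s) (Σ<-mono n λ i i<n → f≤g (suc i) (s<s i<n)) eq)) i i<n

Σ<-last : ∀ n f → Σ< (suc n) f ≡ Σ< n f + f n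
Σ<-last zero    f = +-comm (f 0) 0
Σ<-last (suc n) f = trans (cong (f 0 +_) (Σ<-last n (f ∘ suc))) (sym (+-assoc (f 0) _ _))

Σ<-rotate : ∀ n f → (∀ j → f (j + n) ≡ f j) → ∀ p → Σ< n (λ j → f (p + j)) ≡ Σ< n f
Σ<-rotate n f per zero    = refl
Σ<-rotate n f per (suc p) = +-cancelˡ-≡ (f p) _ _ (begin
  f p + Σ< n (λ j → f (suc p + j))
    ≡⟨ cong₂ _+_ (cong f (sym (+-identityʳ p))) (Σ<-cong n λ j _ → cong f (sym (+-suc p j))) ⟩
  Σ< (suc n) (λ j → f (p + j))
    ≡⟨ Σ<-last n (λ j → f (p + j)) ⟩
  Σ< n (λ j → f (p + j)) + f (p + n)
    ≡⟨ cong₂ _+_ (Σ<-rotate n f per p) (per p) ⟩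
  Σ< n f + f p
    ≡⟨ +-comm _ (f p) ⟩
  f p + Σ< n f ∎)
  where open ≡-Reasoning

⟦_⟧ : Bool → ℕ
⟦ b ⟧ = if b then 1 else 0

⟦⟧≤1 : ∀ b → ⟦ b ⟧ ≤ 1
⟦⟧≤1 true  = ≤-refl
⟦⟧≤1 false = z≤n

⟦⟧-injective : ∀ {b} → ⟦ b ⟧ ≡ 1 → b ≡ true
⟦⟧-injective {true} _ = refl

true≢false : ∀ {b : Bool} → b ≡ true → b ≡ false → ⊥
true≢false refl ()

Σ<-complement : ∀ n (b : ℕ → Bool) → Σ< n (⟦_⟧ ∘ b) + Σ< n (⟦_⟧ ∘ not ∘ b) ≡ n
Σ<-complement n b = trans (sym (Σ<-+ n (⟦_⟧ ∘ b) (⟦_⟧ ∘ not ∘ b)))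
  (trans (Σ<-cong n (λ i _ → one (b i))) (trans (Σ<-const n 1) (*-identityʳ n)))
  where
  one : ∀ x → ⟦ x ⟧ + ⟦ not x ⟧ ≡ 1
  one true  = refl
  one false = refl

search : ∀ n (b : ℕ → Bool) → (∃[ i ] i < n × b i ≡ true) ⊎ (∀ i → i < n → b i ≡ false)
search zero    b = inj₂ λ _ ()
search (suc n) b with b 0 in eq | search n (b ∘ suc)
... | true  | _                       = inj₁ (0 , z<s , eq)
... | false | inj₁ (i , i<n , bi)     = inj₁ (suc i , s<s i<n , bi)
... | false | inj₂ none               = inj₂ λ { zero _ → eq ; (suc i) (s<s i<n) → none i i<n }

search-false : ∀ n (b : ℕ → Bool) → (∃[ i ] i < n × b i ≡ false) ⊎ (∀ i → i < n → b i ≡ true)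
search-false n b with search n (not ∘ b)
... | inj₁ (i , i<n , nbi) = inj₁ (i , i<n , trans (sym (not-involutive (b i))) (cong not nbi))
... | inj₂ all             = inj₂ λ i i<n → trans (sym (not-involutive (b i))) (cong not (all i i<n))

-- b marks the starting points of arcs of length N ∸ s on a cycle of length N: the
-- points a 0, …, a k′ below are such that the complementary arcs (of length s) cover
-- the cycle, that is, the k′ + 1 arcs have no common point.
NoCover : (N s k′ : ℕ) → (ℕ → Bool) → Set
NoCover N s k′ b = ∀ (a : ℕ → ℕ) → (∀ i → i < k′ → a (suc i) ≤ a i + s) →
  a 0 + N ≤ a k′ + s → (∀ i → i ≤ k′ → b (a i) ≡ true) → ⊥

-- A degree one map from the cycle of length k s = N + t onto the cycle of length N:
-- a residue class modulo s upstairs is a partition into k arcs of length s, and it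
-- projects to a covering downstairs.
record Collapse (s t : ℕ) (π : ℕ → ℕ) : Set where
  field
    lipschitz : ∀ j → π (j + s) ≤ π j + s
    upper     : ∀ j → π j ≤ j
    lower     : ∀ j → j ≤ π j + t

∸-lipschitz : ∀ s t j → j + s ∸ t ≤ j ∸ t + s
∸-lipschitz s t j = m≤n+o⇒m∸n≤o (j + s) t (begin
  j + s           ≤⟨ +-monoˡ-≤ s (m≤n+m∸n j t) ⟩
  t + (j ∸ t) + s ≡⟨ +-assoc t (j ∸ t) s ⟩
  t + (j ∸ t + s) ∎)
  where open ≤-Reasoning

m≤m∸n+n : ∀ m n → m ≤ m ∸ n + n
m≤m∸n+n m n = subst (m ≤_) (+-comm n (m ∸ n)) (m≤n+m∸n m n)

∸-collapse : ∀ s t → Collapse s t (_∸ t)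
∸-collapse s t = record
  { lipschitz = ∸-lipschitz s t
  ; upper     = λ j → m∸n≤m j t
  ; lower     = λ j → m≤m∸n+n j t
  }

module _ {N s k′ t : ℕ} {b : ℕ → Bool} (ks≡N+t : suc k′ * s ≡ N + t)
         (noCover : NoCover N s k′ b) where

  -- Were all k points marked, their projections would form a forbidden covering: `lipschitz` bounds
  -- each gap by s, and by `upper` and `lower` the whole turn loses at most t, which is the excess
  -- of k s over N.
  class-hit : ∀ {π} → Collapse s t π → ∀ c → ∃[ i ] i < suc k′ × b (π (c + i * s)) ≡ false
  class-hit {π} col c with search-false (suc k′) (λ i → b (π (c + i * s)))
  ... | inj₁ hit = hit
  ... | inj₂ all = ⊥-elim (noCover (λ i → π (c + i * s)) step close λ i i≤k′ → all i (s≤s i≤k′))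
    where
    open Collapse col
    step : ∀ i → i < k′ → π (c + suc i * s) ≤ π (c + i * s) + s
    step i _ = subst (λ j → π j ≤ π (c + i * s) + s)
      (trans (+-assoc c (i * s) s) (cong (c +_) (+-comm (i * s) s))) (lipschitz (c + i * s))
    close : π (c + 0) + N ≤ π (c + k′ * s) + s
    close = +-cancelʳ-≤ t _ _ (begin
      π (c + 0) + N + t           ≤⟨ +-monoˡ-≤ t (+-monoˡ-≤ N (upper (c + 0))) ⟩
      c + 0 + N + t               ≡⟨ solve 3 (λ c N t → c :+ con 0 :+ N :+ t := c :+ (N :+ t)) refl c N t ⟩
      c + (N + t)                 ≡⟨ cong (c +_) (sym ks≡N+t) ⟩
      c + (s + k′ * s)            ≡⟨ solve 3 (λ c s x → c :+ (s :+ x) := c :+ x :+ s) refl c s (k′ * s) ⟩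
      c + k′ * s + s              ≤⟨ +-monoˡ-≤ s (lower (c + k′ * s)) ⟩
      π (c + k′ * s) + t + s      ≡⟨ solve 3 (λ c s x → c :+ s :+ x := c :+ x :+ s) refl (π (c + k′ * s)) t s ⟩
      π (c + k′ * s) + s + t      ∎)
      where
      open ≤-Reasoning
      open +-*-Solver

  module _ (b0 : b 0 ≡ true) where

    classes : ℕ → ℕ
    classes c = Σ< (suc k′) (λ i → ⟦ not (b (c + i * s ∸ t)) ⟧)

    -- The first t positions upstairs project to 0, which is marked by `b0`, so the extra points
    -- contribute no miss.
    Σ<-classes≡ : Σ< s classes ≡ Σ< N (⟦_⟧ ∘ not ∘ b)
    Σ<-classes≡ = begin
      Σ< s classes
        ≡⟨ Σ<-classes (suc k′) s (λ j → ⟦ not (b (j ∸ t)) ⟧) ⟨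
      Σ< (suc k′ * s) (λ j → ⟦ not (b (j ∸ t)) ⟧)
        ≡⟨ cong (λ x → Σ< x (λ j → ⟦ not (b (j ∸ t)) ⟧)) (trans ks≡N+t (+-comm N t)) ⟩
      Σ< (t + N) (λ j → ⟦ not (b (j ∸ t)) ⟧)
        ≡⟨ Σ<-split t N _ ⟩
      Σ< t (λ j → ⟦ not (b (j ∸ t)) ⟧) + Σ< N (λ j → ⟦ not (b (t + j ∸ t)) ⟧)
        ≡⟨ cong₂ _+_
             (trans (Σ<-cong t λ j j<t → cong (λ x → ⟦ not x ⟧) (trans (cong b (m≤n⇒m∸n≡0 (<⇒≤ j<t))) b0))
                    (trans (Σ<-const t 0) (*-zeroʳ t)))
             (Σ<-cong N λ j _ → cong (λ x → ⟦ not (b x) ⟧) (m+n∸m≡n t j)) ⟩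
      Σ< N (⟦_⟧ ∘ not ∘ b) ∎
      where open ≡-Reasoning

    class≥1 : ∀ c → 1 ≤ classes c
    class≥1 c with i , i<k , bi ← class-hit (∸-collapse s t) c =
      subst (_≤ classes c) (cong (λ x → ⟦ not x ⟧) bi) 
        (Σ<-term (suc k′) (λ i → ⟦ not (b (c + i * s ∸ t)) ⟧) i i<k)

    s≤missing : s ≤ Σ< N (⟦_⟧ ∘ not ∘ b)
    s≤missing = begin
      s                    ≡⟨ *-identityʳ s ⟨
      s * 1                ≡⟨ Σ<-const s 1 ⟨
      Σ< s (λ _ → 1)       ≤⟨ Σ<-mono s (λ c _ → class≥1 c) ⟩
      Σ< s classes         ≡⟨ Σ<-classes≡ ⟩
      Σ< N (⟦_⟧ ∘ not ∘ b) ∎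
      where open ≤-Reasoning

-- Moving one of the t extra points from 0 to d + 1 shifts the arcs starting in [1 , d]
-- by one place relative to the others, so that the class of d is no longer hit.
module _ {N s k′ t′ : ℕ} {b : ℕ → Bool} (ks≡N+t : suc k′ * s ≡ N + suc t′)
         (noCover : NoCover N s k′ b)
         (b0 : b 0 ≡ true) (b1 : b 1 ≡ false)
         (tight : Σ< N (⟦_⟧ ∘ not ∘ b) ≡ s) where

  private
    t = suc t′

  -- There are s classes with at least one miss each, and only s misses in all.
  class≡1 : ∀ c → c < s → classes {b = b} ks≡N+t noCover b0 c ≡ 1
  class≡1 c c<s = sym (Σ<-squeeze s (λ c _ → class≥1 {b = b} ks≡N+t noCover b0 c)
    (trans (Σ<-const s 1) (trans (*-identityʳ s) (sym (trans (Σ<-classes≡ {b = b} ks≡N+t noCover b0) tight)))) c c<s)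

  module _ {d : ℕ} (bd : b d ≡ false) (d<s : d < s) where

    bend : ℕ → ℕ
    bend j with j ≤? t + d
    ... | yes _ = j ∸ t′
    ... | no _  = j ∸ t

    bend-≤ : ∀ {j} → j ≤ t + d → bend j ≡ j ∸ t′
    bend-≤ {j} le with j ≤? t + d
    ... | yes _ = refl
    ... | no nle = contradiction le nle

    bend-> : ∀ {j} → t + d < j → bend j ≡ j ∸ t
    bend-> {j} gt with j ≤? t + d
    ... | yes le = contradiction le (<⇒≱ gt)
    ... | no _ = refl

    bend-collapse : Collapse s t bend
    bend-collapse = record { lipschitz = lip ; upper = up ; lower = low }
      where
      lip : ∀ j → bend (j + s) ≤ bend j + s
      lip j with j ≤? t + d | j + s ≤? t + d
      ... | yes _ | yes _ = ∸-lipschitz s t′ j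
      ... | yes _ | no _  = ≤-trans (∸-monoʳ-≤ (j + s) (n≤1+n t′)) (∸-lipschitz s t′ j)
      ... | no ¬p | yes q = contradiction (≤-trans (m≤m+n j s) q) ¬p
      ... | no _  | no _  = ∸-lipschitz s t j
      up : ∀ j → bend j ≤ j
      up j with j ≤? t + d
      ... | yes _ = m∸n≤m j t′
      ... | no _  = m∸n≤m j t
      low : ∀ j → j ≤ bend j + t
      low j with j ≤? t + d
      ... | yes _ = ≤-trans (m≤m∸n+n j t′) (+-monoʳ-≤ (j ∸ t′) (n≤1+n t′))
      ... | no _  = m≤m∸n+n j t

    -- Under `bend` the point t + d moves from d to d + 1. If d + 1 were marked, the class of t + d
    -- would have its miss elsewhere. Earlier members of the class lie over 0, which is marked;
    -- later ones have the same image under both collapses, so a miss there would be a second one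
    -- next to d in a class that has only one.
    next-false : b (suc d) ≡ false
    next-false with b (suc d) in bsd
    ... | false = refl
    ... | true  = ⊥-elim contra
      where
      instance
        s≢0 : NonZero s
        s≢0 = >-nonZero (≤-<-trans z≤n d<s)
      c i₀ : ℕ
      c  = (t + d) % s
      i₀ = (t + d) / s
      t+d≡ : t + d ≡ c + i₀ * s
      t+d≡ = m≡m%n+[m/n]*n (t + d) s
      contra : ⊥
      contra with i , i<k , bi ← class-hit {b = b} ks≡N+t noCover bend-collapse c with <-cmp i i₀
      ... | tri≈ _ refl _ = true≢false
        (trans (cong b (trans (bend-≤ (≤-reflexive (sym t+d≡)))
          (trans (cong (_∸ t′) (sym t+d≡)) (trans (cong (_∸ t′) (sym (+-suc t′ d))) (m+n∸m≡n t′ (suc d)))))) bsd) bi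
      ... | tri< i<i₀ _ _ = true≢false
        (trans (cong b (trans (bend-≤ (≤-trans le (≤-trans (n≤1+n t′) (m≤m+n t d)))) (m≤n⇒m∸n≡0 le))) b0) bi
        where
        -- One step of length s back from t + d already lands below t, because d < s.
        le : c + i * s ≤ t′
        le = s≤s⁻¹ (+-cancelʳ-< s _ _ (begin-strict
          c + i * s + s   ≡⟨ trans (+-assoc c (i * s) s) (cong (c +_) (+-comm (i * s) s)) ⟩
          c + suc i * s   ≤⟨ +-monoʳ-≤ c (*-monoˡ-≤ s i<i₀) ⟩
          c + i₀ * s      ≡⟨ t+d≡ ⟨
          t + d           <⟨ +-monoʳ-< t d<s ⟩
          t + s           ∎))
          where open ≤-Reasoning
      ... | tri> _ _ i₀<i = <⇒≱ (n<1+n 1) (begin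
          2             ≡⟨ cong₂ _+_ (cong (λ x → ⟦ not x ⟧) bi₀) (cong (λ x → ⟦ not x ⟧) bi′) ⟨
          term i₀ + term i ≤⟨ Σ<-two-terms (suc k′) term i₀ i i₀<i i<k ⟩
          classes {b = b} ks≡N+t noCover b0 c ≡⟨ class≡1 c (m%n<n (t + d) s) ⟩
          1             ∎)
        where
        open ≤-Reasoning
        term : ℕ → ℕ
        term i = ⟦ not (b (c + i * s ∸ t)) ⟧
        bi₀ : b (c + i₀ * s ∸ t) ≡ false
        bi₀ = trans (cong b (trans (cong (_∸ t) (sym t+d≡)) (m+n∸m≡n t d))) bd
        gt : t + d < c + i * s
        gt = subst (_< c + i * s) (sym t+d≡) (+-monoʳ-< c (*-monoˡ-< s i₀<i))
        bi′ : b (c + i * s ∸ t) ≡ false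
        bi′ = trans (cong b (sym (bend-> gt))) bi

  run-false : ∀ d → 1 ≤ d → d ≤ s → b d ≡ false
  run-false (suc zero)    _ _   = b1
  run-false (suc (suc d)) _ d≤s = next-false (run-false (suc d) (s≤s z≤n) (<⇒≤ d≤s)) d≤s

noCover-shift : ∀ {N s k′ b} → NoCover N s k′ b → ∀ p → NoCover N s k′ (λ j → b (p + j))
noCover-shift {N} {s} {k′} noCover p a step close = noCover (λ i → p + a i)
  (λ i i<k′ → ≤-trans (+-monoʳ-≤ p (step i i<k′)) (≤-reflexive (sym (+-assoc p (a i) s))))
  (≤-trans (≤-reflexive (+-assoc p (a 0) N))
    (≤-trans (+-monoʳ-≤ p close) (≤-reflexive (sym (+-assoc p (a k′) s)))))

descent : ∀ (b : ℕ → Bool) d p → b p ≡ true → b (p + d) ≡ false →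
  ∃[ q ] b q ≡ true × b (suc q) ≡ false
descent b zero    p bp bpd = ⊥-elim (true≢false bp (trans (cong b (sym (+-identityʳ p))) bpd))
descent b (suc d) p bp bpd with b (suc p) in bsp
... | false = p , bp , bsp
... | true  = descent b d (suc p) bsp (trans (cong b (sym (+-suc p d))) bpd)

module _ {N r s : ℕ} {b : ℕ → Bool} (r+s≡N : r + s ≡ N) (periodic : ∀ j → b (j + N) ≡ b j) where

  private
    rotate : ∀ p (g : Bool → ℕ) → Σ< N (λ j → g (b (p + j))) ≡ Σ< N (g ∘ b)
    rotate p g = Σ<-rotate N (g ∘ b) (cong g ∘ periodic) p

  -- A full turn has r marks, and just r positions remain after the empty stretch of length s.
  rest-true : Σ< N (⟦_⟧ ∘ b) ≡ r → ∀ p → (∀ j → 1 ≤ j → j ≤ s → b (p + j) ≡ false) →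
    ∀ j → s < j → j ≤ N → b (p + j) ≡ true
  rest-true full p empty = filled
    where
    tail-full : Σ< r (λ i → ⟦ b (suc p + (s + i)) ⟧) ≡ Σ< r (λ _ → 1)
    tail-full = begin
      Σ< r (λ i → ⟦ b (suc p + (s + i)) ⟧)
        ≡⟨ cong (_+ Σ< r (λ i → ⟦ b (suc p + (s + i)) ⟧)) (trans (Σ<-cong s λ i i<s →
             cong ⟦_⟧ (trans (cong b (sym (+-suc p i))) (empty (suc i) (s≤s z≤n) i<s)))
             (trans (Σ<-const s 0) (*-zeroʳ s))) ⟨
      Σ< s (λ i → ⟦ b (suc p + i) ⟧) + Σ< r (λ i → ⟦ b (suc p + (s + i)) ⟧)
        ≡⟨ Σ<-split s r (λ i → ⟦ b (suc p + i) ⟧) ⟨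
      Σ< (s + r) (λ i → ⟦ b (suc p + i) ⟧)
        ≡⟨ cong (λ x → Σ< x (λ i → ⟦ b (suc p + i) ⟧)) (trans (+-comm s r) r+s≡N) ⟩
      Σ< N (λ i → ⟦ b (suc p + i) ⟧)
        ≡⟨ rotate (suc p) ⟦_⟧ ⟩
      Σ< N (⟦_⟧ ∘ b)
        ≡⟨ trans full (sym (trans (Σ<-const r 1) (*-identityʳ r))) ⟩
      Σ< r (λ _ → 1) ∎
      where open ≡-Reasoning

    filled : ∀ j → s < j → j ≤ N → b (p + j) ≡ true
    filled j s<j j≤N = trans (cong b (trans (cong (p +_) (sym (m+[n∸m]≡n s<j)))
        (+-suc p (s + i)))) (⟦⟧-injective (Σ<-squeeze r (λ i _ → ⟦⟧≤1 (b (suc p + (s + i)))) tail-full i i<r))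
      where
      i : ℕ
      i = j ∸ suc s
      i<r : i < r
      i<r = +-cancelˡ-≤ s _ _ (≤-trans (≤-reflexive (trans (+-suc s i) (m+[n∸m]≡n s<j)))
        (≤-trans j≤N (≤-reflexive (trans (sym r+s≡N) (+-comm r s)))))

  module _ {k′ t : ℕ} (ks≡N+t : suc k′ * s ≡ N + t) (noCover : NoCover N s k′ b) where

    circle-bound : Σ< N (⟦_⟧ ∘ b) ≤ r
    circle-bound with search N b
    ... | inj₂ none = subst (_≤ r)
      (sym (trans (Σ<-cong N λ i i<N → cong ⟦_⟧ (none i i<N)) (trans (Σ<-const N 0) (*-zeroʳ N)))) z≤n
    -- The cycle is rotated so that the extra points are stacked on the marked position p.
    ... | inj₁ (p , _ , bp) = +-cancelʳ-≤ s _ _ (begin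
      Σ< N (⟦_⟧ ∘ b) + s
        ≤⟨ +-monoʳ-≤ _ (s≤missing {b = λ j → b (p + j)} ks≡N+t (noCover-shift {b = b} noCover p)
             (trans (cong b (+-identityʳ p)) bp)) ⟩
      Σ< N (⟦_⟧ ∘ b) + Σ< N (λ j → ⟦ not (b (p + j)) ⟧)
        ≡⟨ cong (Σ< N (⟦_⟧ ∘ b) +_) (rotate p (⟦_⟧ ∘ not)) ⟩
      Σ< N (⟦_⟧ ∘ b) + Σ< N (⟦_⟧ ∘ not ∘ b)
        ≡⟨ Σ<-complement N b ⟩
      N
        ≡⟨ r+s≡N ⟨
      r + s ∎)
      where open ≤-Reasoning

    -- The origin is put at a marked position followed by an unmarked one, and `run-false` extends
    -- the gap to s places. The starting points p + j with s < j ≤ N are those whose arcs reach p +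
    -- N, that is, contain p.
    circle-centre : 1 ≤ t → 1 ≤ r → 1 ≤ s → Σ< N (⟦_⟧ ∘ b) ≡ r →
      ∃[ p ] (∀ j → 1 ≤ j → j ≤ s → b (p + j) ≡ false) × (∀ j → s < j → j ≤ N → b (p + j) ≡ true)
    circle-centre (s≤s {n = t′} _) 1≤r 1≤s full = centre
      where
      missing : Σ< N (⟦_⟧ ∘ not ∘ b) ≡ s
      missing = +-cancelˡ-≡ r _ _ (trans (cong (_+ _) (sym full)) (trans (Σ<-complement N b) (sym r+s≡N)))

      some : ∃[ p ] b p ≡ true
      some with search N b
      ... | inj₁ (p , _ , bp) = p , bp
      ... | inj₂ none = contradiction (trans (sym full)
        (trans (Σ<-cong N λ i i<N → cong ⟦_⟧ (none i i<N)) (trans (Σ<-const N 0) (*-zeroʳ N)))) (>⇒≢ 1≤r)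

      boundary : ∃[ q ] b q ≡ true × b (suc q) ≡ false
      boundary with p , bp ← some with search-false N (λ j → b (p + j))
      ... | inj₁ (d , _ , bpd) = descent b d p bp bpd
      ... | inj₂ all = contradiction (trans (sym missing) (trans (sym (rotate p (⟦_⟧ ∘ not)))
        (trans (Σ<-cong N λ i i<N → cong (⟦_⟧ ∘ not) (all i i<N)) (trans (Σ<-const N 0) (*-zeroʳ N))))) (>⇒≢ 1≤s)

      centre : ∃[ p ] (∀ j → 1 ≤ j → j ≤ s → b (p + j) ≡ false) × (∀ j → s < j → j ≤ N → b (p + j) ≡ true)
      centre with p , bp , bsp ← boundary = p , empty , rest-true full p empty
        where
        empty : ∀ j → 1 ≤ j → j ≤ s → b (p + j) ≡ false
        empty = run-false {b = λ j → b (p + j)} ks≡N+t (noCover-shift {b = b} noCover p)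
          (trans (cong b (+-identityʳ p)) bp) (trans (cong b (+-comm p 1)) bsp)
          (trans (rotate p (⟦_⟧ ∘ not)) missing)

-- Arrangements of the vertices on a cycle

-- Pigeonhole by induction on `xs`: deleting x from `ys` preserves all hypotheses. It serves
-- wherever an injection between finite sets has to be onto.
unique-⊆-reverse : ∀ {a} {A : Set a} {xs ys : List A} → Unique xs → (∀ {x} → x ∈ₗ xs → x ∈ₗ ys) →
  length ys ≤ length xs → ∀ {y} → y ∈ₗ ys → y ∈ₗ xs
unique-⊆-reverse {xs = []} {_ ∷ _} _ _ ()
unique-⊆-reverse {xs = x ∷ xs} (x∉xs ∷ uxs) xs⊆ys le y∈ys with ∈-∃++ (xs⊆ys (here refl))
... | ys₁ , ys₂ , refl = [ in-rest ∘ ∈-++⁺ˡ , (λ { (here y≡x) → here y≡x ; (there y∈) → in-rest (∈-++⁺ʳ ys₁ y∈) }) ]′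
                           (∈-++⁻ ys₁ y∈ys)
  where
  rest⊆ : ∀ {z} → z ∈ₗ xs → z ∈ₗ ys₁ ++ ys₂
  rest⊆ z∈xs with ∈-++⁻ ys₁ (xs⊆ys (there z∈xs))
  ... | inj₁ z∈ys₁          = ∈-++⁺ˡ z∈ys₁
  ... | inj₂ (here refl)    = contradiction z∈xs (All¬⇒¬Any x∉xs)
  ... | inj₂ (there z∈ys₂)  = ∈-++⁺ʳ ys₁ z∈ys₂
  rest≤ : length (ys₁ ++ ys₂) ≤ length xs
  rest≤ = s≤s⁻¹ (subst (_≤ suc (length xs))
    (trans (length-++ ys₁) (trans (+-suc _ _) (cong suc (sym (length-++ ys₁))))) le)
  in-rest : ∀ {z} → z ∈ₗ ys₁ ++ ys₂ → z ∈ₗ x ∷ xs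
  in-rest z∈ = there (unique-⊆-reverse uxs rest⊆ rest≤ z∈)

∣⁅x⁆∪p∣ : ∀ {m} {x : Fin m} {p : Subset m} → x ∉ p → ∣ ⁅ x ⁆ ∪ p ∣ ≡ suc ∣ p ∣
∣⁅x⁆∪p∣ {x = zero}  {true Vec.∷ p}  x∉p = contradiction Vec.here x∉p
∣⁅x⁆∪p∣ {x = zero}  {false Vec.∷ p} x∉p = cong (suc ∘ ∣_∣) (∪-identityˡ p)
∣⁅x⁆∪p∣ {x = suc x} {true Vec.∷ p}  x∉p = cong suc (∣⁅x⁆∪p∣ (x∉p ∘ Vec.there))
∣⁅x⁆∪p∣ {x = suc x} {false Vec.∷ p} x∉p = ∣⁅x⁆∪p∣ (x∉p ∘ Vec.there)

⊆∧≡⇒≡ : ∀ {m} {p q : Subset m} → p ⊆ q → ∣ q ∣ ≤ ∣ p ∣ → p ≡ q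
⊆∧≡⇒≡ {p = p} {q} p⊆q le = ⊆-antisym p⊆q q⊆p
  where
  q⊆p : q ⊆ p
  q⊆p {x} x∈q with x ∈? p
  ... | yes x∈p = x∈p
  ... | no x∉p  = contradiction (p⊂q⇒∣p∣<∣q∣ (p⊆q , x , x∈q , x∉p)) (≤⇒≯ le)

∈-⋂-tabulate⁻ : ∀ {m k} (A : Fin k → Subset m) {u} → u ∈ ⋂ (tabulate A) → ∀ i → u ∈ A i
∈-⋂-tabulate⁻ A u∈ zero    = p∩q⊆p _ _ u∈
∈-⋂-tabulate⁻ A u∈ (suc i) = ∈-⋂-tabulate⁻ (A ∘ suc) (p∩q⊆q (A zero) _ u∈) i

setOf : ∀ {m} → List (Fin m) → Subset m
setOf []       = ∅
setOf (x ∷ xs) = ⁅ x ⁆ ∪ setOf xs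

∈-setOf⁺ : ∀ {m} {xs : List (Fin m)} {x} → x ∈ₗ xs → x ∈ setOf xs
∈-setOf⁺ (here refl) = x∈p∪q⁺ (inj₁ (x∈⁅x⁆ _))
∈-setOf⁺ (there x∈)  = x∈p∪q⁺ (inj₂ (∈-setOf⁺ x∈))

∈-setOf⁻ : ∀ {m} (xs : List (Fin m)) {x} → x ∈ setOf xs → x ∈ₗ xs
∈-setOf⁻ []       x∈ = contradiction x∈ ∉⊥
∈-setOf⁻ (y ∷ xs) x∈ with x∈p∪q⁻ ⁅ y ⁆ (setOf xs) x∈
... | inj₁ x∈y  = here (x∈⁅y⁆⇒x≡y y x∈y)
... | inj₂ x∈xs = there (∈-setOf⁻ xs x∈xs)

∣setOf∣ : ∀ {m} {xs : List (Fin m)} → Unique xs → ∣ setOf xs ∣ ≡ length xs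
∣setOf∣ {m} []        = ∣⊥∣≡0 m
∣setOf∣ {xs = x ∷ xs} (x∉xs ∷ uxs) =
  trans (∣⁅x⁆∪p∣ (All¬⇒¬Any x∉xs ∘ ∈-setOf⁻ xs)) (cong suc (∣setOf∣ uxs))

module Antipode (n : ℕ) where

  N : ℕ
  N = 2 * n

  V : Set
  V = Fin N

  N≡n+n : N ≡ n + n
  N≡n+n = cong (n +_) (+-identityʳ n)

  pairOf : V → Fin n
  pairOf = remainder {2} n

  anti : V → V
  anti u = combine (opposite (quotient {2} n u)) (pairOf u)

  private
    quotient-combine : ∀ (q : Fin 2) (i : Fin n) → quotient {2} n (combine q i) ≡ q
    quotient-combine q i = cong proj₁ (remQuot-combine q i)

    combine-parts : ∀ u → combine {2} (quotient {2} n u) (pairOf u) ≡ u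
    combine-parts = combine-remQuot {2} n

    opposite≢ : ∀ (q : Fin 2) → opposite q ≢ q
    opposite≢ zero       ()
    opposite≢ (suc zero) ()

    opposite-or-≡ : ∀ (p q : Fin 2) → p ≡ q ⊎ p ≡ opposite q
    opposite-or-≡ zero       zero       = inj₁ refl
    opposite-or-≡ zero       (suc zero) = inj₂ refl
    opposite-or-≡ (suc zero) zero       = inj₂ refl
    opposite-or-≡ (suc zero) (suc zero) = inj₁ refl

  pairOf-anti : ∀ u → pairOf (anti u) ≡ pairOf u
  pairOf-anti u = cong proj₂ (remQuot-combine (opposite (quotient {2} n u)) (pairOf u))

  anti-involutive : ∀ u → anti (anti u) ≡ u
  anti-involutive u = trans
    (cong₂ combine (trans (cong opposite (quotient-combine (opposite (quotient {2} n u)) (pairOf u))) (opposite-involutive (quotient {2} n u))) (pairOf-anti u))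
    (combine-parts u)

  anti-≢ : ∀ u → anti u ≢ u
  anti-≢ u eq = opposite≢ (quotient {2} n u) (trans (sym (quotient-combine _ _)) (cong (quotient {2} n) eq))

  pairOf-≡ : ∀ u w → pairOf u ≡ pairOf w → u ≡ w ⊎ u ≡ anti w
  pairOf-≡ u w eq with opposite-or-≡ (quotient {2} n u) (quotient {2} n w)
  ... | inj₁ q≡ = inj₁ (trans (sym (combine-parts u)) (trans (cong₂ combine q≡ eq) (combine-parts w)))
  ... | inj₂ q≡ = inj₂ (trans (sym (combine-parts u)) (cong₂ combine q≡ eq))

  open Graph (M n)

  adj-anti : ∀ u → Adj u (anti u)
  adj-anti u = (λ eq → anti-≢ u (sym eq)) , sym (pairOf-anti u)

  adj⇒anti : ∀ {u w} → Adj u w → w ≡ anti u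
  adj⇒anti {u} {w} (u≢w , eq) with pairOf-≡ w u (sym eq)
  ... | inj₁ w≡u = contradiction (sym w≡u) u≢w
  ... | inj₂ w≡  = w≡

  -- Positions range over all of ℕ, so that shifts and arcs need no modular arithmetic. Period N
  -- results from applying `antiperiodic` twice.
  record Arrangement (v : ℕ → V) : Set where
    field
      antiperiodic : ∀ j → v (n + j) ≡ anti (v j)
      injective    : ∀ j m → 0 < m → m < N → v (j + m) ≢ v j

  open Arrangement public

  arc : (ℕ → V) → ℕ → ℕ → Subset N
  arc v j ℓ = setOf (applyUpTo (λ i → v (j + i)) ℓ)

  ∈-arc⁺ : ∀ v j {ℓ i} → i < ℓ → v (j + i) ∈ arc v j ℓ
  ∈-arc⁺ v j i<ℓ = ∈-setOf⁺ (∈-applyUpTo⁺ (λ i → v (j + i)) i<ℓ)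

  ∈-arc⁻ : ∀ v j ℓ {u} → u ∈ arc v j ℓ → ∃[ i ] i < ℓ × u ≡ v (j + i)
  ∈-arc⁻ v j ℓ u∈ = ∈-applyUpTo⁻ (λ i → v (j + i)) (∈-setOf⁻ (applyUpTo (λ i → v (j + i)) ℓ) u∈)

  arc-cong : ∀ v w j j′ ℓ → (∀ i → v (j + i) ≡ w (j′ + i)) → arc v j ℓ ≡ arc w j′ ℓ
  arc-cong v w j j′ ℓ eq = ⊆-antisym
    (λ u∈ → let i , i<ℓ , u≡ = ∈-arc⁻ v j ℓ u∈ in subst (_∈ arc w j′ ℓ) (sym (trans u≡ (eq i))) (∈-arc⁺ w j′ {ℓ} i<ℓ))
    (λ u∈ → let i , i<ℓ , u≡ = ∈-arc⁻ w j′ ℓ u∈ in subst (_∈ arc v j ℓ) (sym (trans u≡ (sym (eq i)))) (∈-arc⁺ v j {ℓ} i<ℓ))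

  module _ {v : ℕ → V} (arr : Arrangement v) where

    periodic : ∀ j → v (j + N) ≡ v j
    periodic j = begin
      v (j + N)         ≡⟨ cong v (trans (+-comm j N) (trans (cong (_+ j) N≡n+n) (+-assoc n n j))) ⟩
      v (n + (n + j))   ≡⟨ antiperiodic arr (n + j) ⟩
      anti (v (n + j))  ≡⟨ cong anti (antiperiodic arr j) ⟩
      anti (anti (v j)) ≡⟨ anti-involutive (v j) ⟩
      v j               ∎
      where open ≡-Reasoning

    distinct : ∀ j {i i′} → i < i′ → i′ < N → v (j + i) ≢ v (j + i′)
    distinct j {i} {i′} i<i′ i′<N eq = injective arr (j + i) (i′ ∸ i) (m<n⇒0<n∸m i<i′)
      (≤-<-trans (m∸n≤m i′ i) i′<N)
      (trans (cong v (trans (+-assoc j i _) (cong (j +_) (m+[n∸m]≡n (<⇒≤ i<i′))))) (sym eq))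

    unique-arc : ∀ j ℓ → ℓ ≤ N → Unique (applyUpTo (λ i → v (j + i)) ℓ)
    unique-arc j ℓ ℓ≤N = Unique.applyUpTo⁺₁ _ ℓ λ i<i′ i′<ℓ → distinct j i<i′ (<-≤-trans i′<ℓ ℓ≤N)

    ∣arc∣ : ∀ j {ℓ} → ℓ ≤ N → ∣ arc v j ℓ ∣ ≡ ℓ
    ∣arc∣ j {ℓ} ℓ≤N = trans (∣setOf∣ (unique-arc j ℓ ℓ≤N)) (length-applyUpTo _ ℓ)

    surjective : ∀ u → ∃[ j ] j < N × u ≡ v j
    surjective u = ∈-applyUpTo⁻ v (unique-⊆-reverse (unique-arc 0 N ≤-refl) (λ _ → ∈-allFin _)
      (≤-reflexive (trans (length-tabulate {n = N} id) (sym (length-applyUpTo v N)))) (∈-allFin u))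

    arc-periodic : ∀ j ℓ → arc v (j + N) ℓ ≡ arc v j ℓ
    arc-periodic j ℓ = arc-cong v v (j + N) j ℓ λ i → trans
      (cong v (trans (+-assoc j N i) (trans (cong (j +_) (+-comm N i)) (sym (+-assoc j i N))))) (periodic (j + i))

    ∉-arc : ∀ j {ℓ} m → 0 < m → m + ℓ ≤ N → v j ∉ arc v (j + m) ℓ
    ∉-arc j {ℓ} m 0<m le vj∈ with i , i<ℓ , eq ← ∈-arc⁻ v (j + m) ℓ vj∈ =
      injective arr j (m + i) (<-≤-trans 0<m (m≤m+n m i)) (<-≤-trans (+-monoʳ-< m i<ℓ) le)
        (trans (cong v (sym (+-assoc j m i))) (sym eq))

    ∁-arc : ∀ j {r s} → r + s ≡ N → ∁ (arc v j s) ≡ arc v (j + s) r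
    ∁-arc j {r} {s} r+s≡N = sym (⊆∧≡⇒≡ ⊆∁ (≤-reflexive card))
      where
      ⊆∁ : arc v (j + s) r ⊆ ∁ (arc v j s)
      ⊆∁ {u} u∈ = x∉p⇒x∈∁p λ u∈s → absurd (∈-arc⁻ v (j + s) r u∈) (∈-arc⁻ v j s u∈s)
        where
        absurd : (∃[ i ] i < r × u ≡ v (j + s + i)) → (∃[ i ] i < s × u ≡ v (j + i)) → ⊥
        absurd (i , i<r , refl) (i′ , i′<s , eq) = distinct j {i′} {s + i} (<-≤-trans i′<s (m≤m+n s i))
          (subst (s + i <_) (trans (+-comm s r) r+s≡N) (+-monoʳ-< s i<r))
          (trans (sym eq) (cong v (+-assoc j s i)))
      card : ∣ ∁ (arc v j s) ∣ ≡ ∣ arc v (j + s) r ∣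
      card = begin
        ∣ ∁ (arc v j s) ∣  ≡⟨ ∣∁p∣≡n∸∣p∣ (arc v j s) ⟩
        N ∸ ∣ arc v j s ∣  ≡⟨ cong (N ∸_) (∣arc∣ j (subst (s ≤_) r+s≡N (m≤n+m s r))) ⟩
        N ∸ s              ≡⟨ cong (_∸ s) (sym r+s≡N) ⟩
        r + s ∸ s          ≡⟨ m+n∸n≡m r s ⟩
        r                  ≡⟨ ∣arc∣ (j + s) (subst (r ≤_) r+s≡N (m≤m+n r s)) ⟨
        ∣ arc v (j + s) r ∣ ∎
        where open ≡-Reasoning

    -- The antipode of a vertex of the arc stands n places further on, past the end of an arc of
    -- length at most n.
    arc-independent : ∀ j {ℓ} → ℓ ≤ n → Independent (M n) (arc v j ℓ)
    arc-independent j {ℓ} ℓ≤n {u} {w} u∈ w∈ adj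
      with a , a<ℓ , u≡ ← ∈-arc⁻ v j ℓ u∈ | b , b<ℓ , w≡ ← ∈-arc⁻ v j ℓ w∈ =
      distinct j {b} {n + a} (<-≤-trans b<ℓ (≤-trans ℓ≤n (m≤m+n n a)))
        (subst (n + a <_) (sym N≡n+n) (+-monoʳ-< n (<-≤-trans a<ℓ ℓ≤n))) (begin
        v (j + b)        ≡⟨ w≡ ⟨
        w                ≡⟨ adj⇒anti adj ⟩
        anti u           ≡⟨ cong anti u≡ ⟩
        anti (v (j + a)) ≡⟨ antiperiodic arr (j + a) ⟨
        v (n + (j + a))  ≡⟨ cong v (trans (sym (+-assoc n j a)) (trans (cong (_+ a) (+-comm n j)) (+-assoc j n a))) ⟩
        v (j + (n + a))  ∎)
      where open ≡-Reasoning

  -- Y is a position after the swap and Z the position of the same vertex before it. The exchange at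
  -- n + i accompanies the one at i so that antipodes stay opposite.
  data Moved (i Y : ℕ) : ℕ → Set where
    fixed : Moved i Y Y
    up    : Y ≡ i ⊎ Y ≡ n + i → Moved i Y (suc Y)
    down  : ∀ {Z} → suc Z ≡ Y → Y ≡ suc i ⊎ Y ≡ n + suc i → Moved i Y Z

  -- v′ is obtained from v by exchanging the positions i and i + 1, and n + i and n + i + 1.
  Swapped : ℕ → (ℕ → V) → (ℕ → V) → Set
  Swapped i v v′ = ∀ Y → 1 ≤ Y → Y < N → ∃[ Z ] v′ Y ≡ v Z × Moved i Y Z

-- Arcs of an intersecting family on one arrangement, and adjacent swaps.

_≟ˢ_ : ∀ {m} (A B : Subset m) → Dec (A ≡ B)
_≟ˢ_ = ≡-dec Bool._≟_

_∈ᶠ?_ : ∀ {m} (A : Subset m) (F : Family m) → Dec (A ∈ᶠ F)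
_∈ᶠ?_ = DecMembership._∈?_ _≟ˢ_

does⇒ : ∀ {p} {P : Set p} (P? : Dec P) → does P? ≡ true → P
does⇒ (yes p) _ = p

-- A discrete intermediate value theorem for a sequence that may go up and down: take the last i
-- with `a i ≤ Y`.
crossing : ∀ k′ (a : ℕ → ℕ) Y → a 0 ≤ Y → Y < a k′ → ∃[ i ] i < k′ × a i ≤ Y × Y < a (suc i)
crossing zero     a Y a0≤Y Y<a = contradiction a0≤Y (<⇒≱ Y<a)
crossing (suc k′) a Y a0≤Y Y<a with a k′ ≤? Y
... | yes ak≤Y = k′ , n<1+n k′ , ak≤Y , Y<a
... | no ak≰Y with i , i<k′ , le , lt ← crossing k′ a Y a0≤Y (≰⇒> ak≰Y) = i , m<n⇒m<1+n i<k′ , le , lt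

module Intersecting (n k′ r s : ℕ) (r+s≡N : r + s ≡ 2 * n) (F : Family (2 * n))
                    (intersecting : WiseIntersecting (suc k′) F) where
  open Antipode n

  opaque
    hit : (ℕ → V) → ℕ → Bool
    hit v j = does (arc v j r ∈ᶠ? F)

    hit-cong : ∀ v j w j′ → arc v j r ≡ arc w j′ r → hit v j ≡ hit w j′
    hit-cong _ _ _ _ = cong (λ A → does (A ∈ᶠ? F))

    hit-does : ∀ v j → hit v j ≡ does (arc v j r ∈ᶠ? F)
    hit-does v j = refl

    hit⁺ : ∀ v j → arc v j r ∈ᶠ F → hit v j ≡ true
    hit⁺ v j = dec-true (arc v j r ∈ᶠ? F)

    hit⁻ : ∀ v j → hit v j ≡ true → arc v j r ∈ᶠ F
    hit⁻ v j = does⇒ (arc v j r ∈ᶠ? F)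

  hit-periodic : ∀ {v} → Arrangement v → ∀ j → hit v (j + N) ≡ hit v j
  hit-periodic {v} arr j = hit-cong v (j + N) v j (arc-periodic arr j r)

  hit-shift : ∀ v p j → hit (λ i → v (p + i)) j ≡ hit v (p + j)
  hit-shift v p j = hit-cong _ j v (p + j) (arc-cong (λ i → v (p + i)) v j (p + j) r λ i → cong v (sym (+-assoc p j i)))

  -- A point of B lies between two consecutive a i, hence outside the arc at the second one.
  no-chain : ∀ {v} → Arrangement v → ∀ a → (∀ i → i < k′ → a (suc i) ≤ a i + s) →
    ∀ {B} → B ∈ᶠ F → (∀ {u} → u ∈ B → ∃[ Y ] a 0 ≤ Y × Y < a k′ × u ≡ v Y) →
    (∀ i → i < k′ → arc v (a (suc i)) r ∈ᶠ F) → ⊥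
  no-chain {v} arr a step {B} B∈F B⊆ arcs∈F = absurd (intersecting A A∈F)
    where
    A : Fin (suc k′) → Subset N
    A zero    = B
    A (suc i) = arc v (a (suc (toℕ i))) r
    A∈F : ∀ i → A i ∈ᶠ F
    A∈F zero    = B∈F
    A∈F (suc i) = arcs∈F (toℕ i) (toℕ<n i)
    missing : ∀ {u} → (∀ i → u ∈ A i) → ∀ {Y} → u ≡ v Y → ∀ i → i < k′ → a i ≤ Y → Y < a (suc i) → ⊥
    missing {u} u∈ {Y} u≡ i i<k′ ai≤Y Y<a =
      ∉-arc arr Y {r} (a (suc i) ∸ Y) (m<n⇒0<n∸m Y<a)
        (≤-trans (+-monoˡ-≤ r (m≤n+o⇒m∸n≤o (a (suc i)) Y (≤-trans (step i i<k′) (+-monoˡ-≤ s ai≤Y))))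
                 (≤-reflexive (trans (+-comm s r) r+s≡N)))
        (subst (v Y ∈_) (cong (λ x → arc v x r) (sym (m+[n∸m]≡n (<⇒≤ Y<a))))
          (subst (_∈ arc v (a (suc i)) r) u≡
            (subst (λ x → u ∈ arc v (a (suc x)) r) (toℕ-fromℕ< i<k′) (u∈ (suc (fromℕ< i<k′))))))
    absurd : (∃[ u ] u ∈ ⋂ (tabulate A)) → ⊥
    absurd (u , u∈) with Y , a0≤Y , Y<a , u≡ ← B⊆ (∈-⋂-tabulate⁻ A u∈ zero)
                   with i , i<k′ , le , lt ← crossing k′ a Y a0≤Y Y<a =
      missing (∈-⋂-tabulate⁻ A u∈) u≡ i i<k′ le lt

  -- The arc at `a 0` plays the role of B: it has length r = N - s, so the closing inequality says
  -- that it ends before `a k′`.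
  hit-noCover : ∀ {v} → Arrangement v → NoCover N s k′ (hit v)
  hit-noCover {v} arr a step close all-hit = no-chain arr a step (hit⁻ v (a 0) (all-hit 0 z≤n)) inside
    (λ i i<k′ → hit⁻ v (a (suc i)) (all-hit (suc i) i<k′))
    where
    inside : ∀ {u} → u ∈ arc v (a 0) r → ∃[ Y ] a 0 ≤ Y × Y < a k′ × u ≡ v Y
    inside u∈ with d , d<r , u≡ ← ∈-arc⁻ v (a 0) r u∈ = a 0 + d , m≤m+n (a 0) d ,
      <-≤-trans (+-monoʳ-< (a 0) d<r) (+-cancelʳ-≤ s _ _ (≤-trans (≤-reflexive (trans (+-assoc (a 0) r s)
        (cong (a 0 +_) r+s≡N))) close)) , u≡

  hits : (ℕ → V) → ℕ
  hits v = Σ< N (⟦_⟧ ∘ hit v)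

  -- For an arrangement this says that the arcs in F are those through `v 0`: started at j in
  -- [1 , N], an arc of length r reaches position N, where `v 0` recurs, just when j > s.
  Centred : (ℕ → V) → Set
  Centred v = (∀ j → 1 ≤ j → j ≤ s → hit v j ≡ false) × (∀ j → s < j → j ≤ N → hit v j ≡ true)

  module _ {t : ℕ} (ks≡N+t : suc k′ * s ≡ N + t) where

    hits≤r : ∀ {v} → Arrangement v → hits v ≤ r
    hits≤r {v} arr = circle-bound {N} {r} {s} {hit v} r+s≡N (hit-periodic {v} arr) {k′} {t} ks≡N+t (hit-noCover {v} arr)

    centred : 1 ≤ t → 1 ≤ r → 1 ≤ s → ∀ {v} → Arrangement v → hits v ≡ r → ∃[ p ] Centred (λ j → v (p + j))
    centred 1≤t 1≤r 1≤s {v} arr full = map₂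
      (λ {p} (empty , filled) → (λ j 1≤j j≤s → trans (hit-shift v p j) (empty j 1≤j j≤s)) ,
                                (λ j s<j j≤N → trans (hit-shift v p j) (filled j s<j j≤N)))
      (circle-centre {N} {r} {s} {hit v} r+s≡N (hit-periodic {v} arr) {k′} {t} ks≡N+t (hit-noCover {v} arr)
        1≤t 1≤r 1≤s full)

  module _ (strict : suc r ≤ k′ * s) (1≤r : 1 ≤ r) where

    -- Seen in `v`, an arc of `v′` that avoids position 0 fills a window hardly longer than r. If it
    -- were in F, then it and k′ arcs of `v` through `v 0`, spaced by s, would have no common point,
    -- since they rule out a window of length k′ s > r. The bounds on i keep `v 0` and its antipode
    -- in place.
    swap-centred : ∀ {i v v′} → 1 ≤ i → suc i < n → Arrangement v → Arrangement v′ → Swapped i v v′ →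
      hits v′ ≡ r → Centred v → Centred v′
    swap-centred {i} {v} {v′} 1≤i i+1<n arr arr′ swapped full (_ , filled) = empty′ ,
      rest-true {b = hit v′} r+s≡N (hit-periodic arr′) full 0 empty′
      where
      s<N : s < N
      s<N = subst (s <_) r+s≡N (+-monoˡ-≤ s 1≤r)

      -- It suffices to find a window of v of length at most k′ s, avoiding position 0, around the arc of v′.
      reduce : ∀ j lo → 1 ≤ lo →
        (∀ Y Z → 1 ≤ Y → j ≤ Y → Y < j + r → Moved i Y Z → lo ≤ Z × Z < lo + k′ * s × Z < N) →
        1 ≤ j → j ≤ s → hit v′ j ≢ true
      reduce j lo 1≤lo window 1≤j j≤s hit-j = no-chain arr a step (hit⁻ v′ j hit-j) inside arcs
        where
        a : ℕ → ℕ
        -- Since lo ≥ 1, every later `a i` exceeds s, and the cap keeps it at most N: this is the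
        -- range in which `filled` provides arcs of F.
        a i = (lo + i * s) ⊓ N
        step : ∀ i → i < k′ → a (suc i) ≤ a i + s
        step i _ = begin
          (lo + (s + i * s)) ⊓ N     ≡⟨ cong (_⊓ N) (solve 3 (λ l s x → l :+ (s :+ x) := l :+ x :+ s) refl lo s (i * s)) ⟩
          (lo + i * s + s) ⊓ N       ≤⟨ ⊓-monoʳ-≤ (lo + i * s + s) (m≤m+n N s) ⟩
          (lo + i * s + s) ⊓ (N + s) ≡⟨ +-distribʳ-⊓ s (lo + i * s) N ⟨
          a i + s                    ∎
          where
          open ≤-Reasoning
          open +-*-Solver
        arcs : ∀ i → i < k′ → arc v (a (suc i)) r ∈ᶠ F
        arcs i _ = hit⁻ v (a (suc i)) (filled (a (suc i))
          (⊓-glb (+-mono-≤ 1≤lo (m≤m+n s (i * s))) s<N) (m⊓n≤n _ N))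
        inside : ∀ {u} → u ∈ arc v′ j r → ∃[ Z ] a 0 ≤ Z × Z < a k′ × u ≡ v Z
        inside u∈ with d , d<r , refl ← ∈-arc⁻ v′ j r u∈
                  with Z , eq , moved ← swapped (j + d) (≤-trans 1≤j (m≤m+n j d))
                         (subst (j + d <_) (trans (+-comm s r) r+s≡N) (+-mono-≤-< j≤s d<r))
                  with lo≤Z , Z<hi , Z<N ← window (j + d) Z (≤-trans 1≤j (m≤m+n j d)) (m≤m+n j d)
                         (+-monoʳ-< j d<r) moved =
          Z , ≤-trans (m⊓n≤m (lo + 0) N) (≤-trans (≤-reflexive (+-identityʳ lo)) lo≤Z) , ⊓-glb Z<hi Z<N , eq

      -- The upper place of each swapped pair; the vertex found there after the swap came from one
      -- place below.
      block : ℕ → Set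
      block x = x ≡ suc i ⊎ x ≡ n + suc i

      block? : ∀ x → Dec (block x)
      block? x = (x ≟ suc i) ⊎-dec (x ≟ n + suc i)

      block-suc : ∀ {x} → x ≡ i ⊎ x ≡ n + i → block (suc x)
      block-suc (inj₁ refl) = inj₁ refl
      block-suc (inj₂ refl) = inj₂ (sym (+-suc n i))

      block≥2 : ∀ {x} → block x → 2 ≤ x
      block≥2 (inj₁ refl) = s≤s 1≤i
      block≥2 (inj₂ refl) = ≤-trans (s≤s 1≤i) (m≤n+m (suc i) n)

      block<N : ∀ {x} → block x → x < N
      block<N (inj₁ refl) = <-≤-trans i+1<n (m≤m+n n _)
      block<N (inj₂ refl) = subst (n + suc i <_) (sym N≡n+n) (+-monoʳ-< n i+1<n)

      arc-end≤N : ∀ {j} → j ≤ s → j + r ≤ N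
      arc-end≤N j≤s = ≤-trans (+-monoˡ-≤ r j≤s) (≤-reflexive (trans (+-comm s r) r+s≡N))

      Z<N : ∀ {j Y Z} → j ≤ s → Y < j + r → Moved i Y Z → Z < N
      Z<N j≤s Y< fixed         = <-≤-trans Y< (arc-end≤N j≤s)
      Z<N j≤s Y< (up at)       = block<N (block-suc at)
      Z<N j≤s Y< (down refl _) = <-trans (n<1+n _) (<-≤-trans Y< (arc-end≤N j≤s))

      -- Both ends of an arc can be affected by the swap only if r = n.
      both-ends : ∀ {j} → block j → block (j + r) → suc (j + r) < j + k′ * s
      both-ends {j} bj bjr = subst (_< j + k′ * s) (+-suc j r) (+-monoʳ-< j two-more)
        where
        r≡n : ∀ {j} → block j → block (j + r) → r ≡ n
        r≡n (inj₁ refl) (inj₁ eq) = contradiction eq (>⇒≢ (m<m+n _ 1≤r))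
        r≡n (inj₁ refl) (inj₂ eq) = +-cancelˡ-≡ (suc i) r n (trans eq (+-comm n (suc i)))
        r≡n (inj₂ refl) (inj₁ eq) = contradiction eq (>⇒≢ (≤-trans (m<n+m (suc i) (≤-trans (s≤s z≤n) i+1<n)) (m≤m+n _ r)))
        r≡n (inj₂ refl) (inj₂ eq) = contradiction eq (>⇒≢ (m<m+n _ 1≤r))
        s≡n : s ≡ n
        s≡n = +-cancelˡ-≡ n s n (trans (cong (_+ s) (sym (r≡n bj bjr))) (trans r+s≡N N≡n+n))
        -- With r = s = n the strict inequality excludes k′ = 1, and then k′ s ≥ 2n exceeds n + 1.
        2≤k′ : 2 ≤ k′
        2≤k′ = *-cancelʳ-< s 1 k′ (≤-trans (≤-reflexive (cong suc (trans (*-identityˡ s) (trans s≡n (sym (r≡n bj bjr)))))) strict)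
        two-more : suc r < k′ * s
        two-more = begin-strict
          suc r     ≡⟨ cong suc (r≡n bj bjr) ⟩
          1 + n     <⟨ +-monoˡ-< n (≤-trans (s≤s (s≤s z≤n)) i+1<n) ⟩
          n + n     ≡⟨ N≡n+n ⟨
          2 * n     ≡⟨ cong (2 *_) s≡n ⟨
          2 * s     ≤⟨ *-monoˡ-≤ s 2≤k′ ⟩
          k′ * s    ∎
          where open ≤-Reasoning

      empty′ : ∀ j → 1 ≤ j → j ≤ s → hit v′ j ≡ false
      empty′ j 1≤j j≤s with hit v′ j in eq
      ... | false = refl
      ... | true with block? j
      -- The left end does not drop, so at most one place is gained, on the right, and k′ s ≥ r + 1
      -- absorbs it.
      ... | no ¬bj = ⊥-elim (reduce j j 1≤j window 1≤j j≤s eq)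
        where
        window : ∀ Y Z → 1 ≤ Y → j ≤ Y → Y < j + r → Moved i Y Z → j ≤ Z × Z < j + k′ * s × Z < N
        window Y Z _ j≤Y Y< moved = lower moved , <-≤-trans (s≤s (upper moved))
            (≤-trans (≤-reflexive (sym (+-suc j r))) (+-monoʳ-≤ j strict)) , Z<N j≤s Y< moved
          where
          lower : ∀ {Z} → Moved i Y Z → j ≤ Z
          lower fixed          = j≤Y
          lower (up _)         = m≤n⇒m≤1+n j≤Y
          lower (down refl bY) = s≤s⁻¹ (≤∧≢⇒< j≤Y λ { refl → ¬bj bY })
          upper : ∀ {Z} → Moved i Y Z → Z ≤ j + r
          upper fixed         = <⇒≤ Y<
          upper (up _)        = Y<
          upper (down refl _) = ≤-trans (n≤1+n _) (<⇒≤ Y<)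
      -- The left end drops to lo = j - 1, which uses up the slack; if the right end grows as well,
      -- `both-ends` supplies one more place.
      ... | yes bj with s≤s {n = lo} 1≤lo ← block≥2 bj = ⊥-elim (reduce (suc lo) lo 1≤lo window 1≤j j≤s eq)
        where
        window : ∀ Y Z → 1 ≤ Y → suc lo ≤ Y → Y < suc lo + r → Moved i Y Z → lo ≤ Z × Z < lo + k′ * s × Z < N
        window Y Z _ j≤Y Y< moved = lower moved , upper moved , Z<N j≤s Y< moved
          where
          lower : ∀ {Z} → Moved i Y Z → lo ≤ Z
          lower fixed         = <⇒≤ j≤Y
          lower (up _)        = <⇒≤ (m≤n⇒m≤1+n j≤Y)
          lower (down refl _) = s≤s⁻¹ j≤Y
          base : lo + r < lo + k′ * s
          base = +-monoʳ-< lo strict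
          upper : ∀ {Z} → Moved i Y Z → Z < lo + k′ * s
          upper fixed         = ≤-<-trans (s≤s⁻¹ Y<) base
          upper (down refl _) = ≤-<-trans (s≤s⁻¹ (<-trans (n<1+n _) Y<)) base
          upper (up at) with m≤n⇒m<n∨m≡n (s≤s⁻¹ Y<)
          ... | inj₁ Y<′  = ≤-<-trans Y<′ base
          ... | inj₂ refl = s≤s⁻¹ (both-ends bj (block-suc at))

-- Arrangements encoded as signed words.

filter-++-¬ : ∀ {a p} {A : Set a} {P : A → Set p} (P? : Decidable P) xs →
  xs ↭ filter P? xs ++ filter (¬? ∘ P?) xs
filter-++-¬ P? []       = refl
filter-++-¬ P? (x ∷ xs) with P? x
... | yes _ = prep x (filter-++-¬ P? xs)
... | no _  = ↭-trans (prep x (filter-++-¬ P? xs)) (↭-sym (shift x (filter P? xs) _))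

split-at : ∀ {a} {A : Set a} (xs : List A) j → j < length xs →
  ∃[ p ] ∃[ y ] ∃[ q ] xs ≡ p ++ y ∷ q × length p ≡ j
split-at (x ∷ xs) zero    _         = [] , x , xs , refl , refl
split-at (x ∷ xs) (suc j) (s<s j<n) with p , y , q , refl , refl ← split-at xs j j<n = x ∷ p , y , q , refl , refl

module Words (n : ℕ) (d : Fin (2 * n)) where
  open Antipode n

  -- The cyclic sequence w, anti w, w, … read off by moving the first letter, inverted, to the end.
  cyc : List V → ℕ → V
  cyc []      _       = d
  cyc (x ∷ w) zero    = x
  cyc (x ∷ w) (suc j) = cyc (w ∷ʳ anti x) j

  cyc-at : ∀ p y q → cyc (p ++ y ∷ q) (length p) ≡ y
  cyc-at []      y q = refl
  cyc-at (x ∷ p) y q = trans (cong (λ l → cyc l (length p)) (++-assoc p (y ∷ q) _)) (cyc-at p y _)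

  -- Reading past p appends its letters inverted, one at a time. With q empty this becomes
  -- antiperiodicity.
  cyc-rotate : ∀ p q j → cyc (p ++ q) (length p + j) ≡ cyc (q ++ map anti p) j
  cyc-rotate []      q j = cong (λ l → cyc l j) (sym (++-identityʳ q))
  cyc-rotate (x ∷ p) q j = begin
    cyc ((p ++ q) ∷ʳ anti x) (length p + j) ≡⟨ cong (λ l → cyc l (length p + j)) (++-assoc p q _) ⟩
    cyc (p ++ (q ∷ʳ anti x)) (length p + j) ≡⟨ cyc-rotate p (q ∷ʳ anti x) j ⟩
    cyc ((q ∷ʳ anti x) ++ map anti p) j     ≡⟨ cong (λ l → cyc l j) (++-assoc q _ _) ⟩
    cyc (q ++ anti x ∷ map anti p) j        ∎
    where open ≡-Reasoning

  cyc-prefix : ∀ p q q′ j → j < length p → cyc (p ++ q) j ≡ cyc (p ++ q′) j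
  cyc-prefix p q q′ j j<p with p₁ , y , p₂ , refl , refl ← split-at p j j<p = begin
    cyc ((p₁ ++ y ∷ p₂) ++ q) (length p₁)  ≡⟨ cong (λ l → cyc l (length p₁)) (++-assoc p₁ (y ∷ p₂) q) ⟩
    cyc (p₁ ++ y ∷ p₂ ++ q) (length p₁)    ≡⟨ cyc-at p₁ y (p₂ ++ q) ⟩
    y                                      ≡⟨ cyc-at p₁ y (p₂ ++ q′) ⟨
    cyc (p₁ ++ y ∷ p₂ ++ q′) (length p₁)   ≡⟨ cong (λ l → cyc l (length p₁)) (++-assoc p₁ (y ∷ p₂) q′) ⟨
    cyc ((p₁ ++ y ∷ p₂) ++ q′) (length p₁) ∎
    where open ≡-Reasoning

  applyUpTo-cyc : ∀ p q → applyUpTo (cyc (p ++ q)) (length p) ≡ p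
  applyUpTo-cyc []      q = refl
  applyUpTo-cyc (x ∷ p) q = cong (x ∷_) (trans
    (cong (λ l → applyUpTo (cyc l) (length p)) (++-assoc p q _)) (applyUpTo-cyc p _))

  cyc-map : ∀ {h : V → V} → (∀ u → h (anti u) ≡ anti (h u)) → ∀ x w j → cyc (map h (x ∷ w)) j ≡ h (cyc (x ∷ w) j)
  cyc-map {h} h-anti x w       zero    = refl
  cyc-map {h} h-anti x []      (suc j) = trans (cong (λ y → cyc [ y ] j) (sym (h-anti x))) (cyc-map h-anti (anti x) [] j)
  cyc-map {h} h-anti x (y ∷ w) (suc j) = trans
    (cong (λ l → cyc (h y ∷ l) j) (trans (cong (map h w ∷ʳ_) (sym (h-anti x))) (sym (map-++ h w _))))
    (cyc-map h-anti y (w ∷ʳ anti x) j)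

  Separated : V → V → Set
  Separated u w = pairOf u ≢ pairOf w

  -- One end of every edge, in some order: a signed permutation of the n edges.
  Valid : List V → Set
  Valid w = length w ≡ n × AllPairs Separated w

  valid? : Decidable Valid
  valid? w = (length w ≟ n) ×-dec allPairs? (λ u w → ¬? (pairOf u ≟ᶠ pairOf w)) w

  valid-↭ : ∀ {w w′} → w ↭ w′ → Valid w → Valid w′
  valid-↭ p (len , sep) = trans (sym (↭-length p)) len ,
    AllPairs-resp-↭ (setoid V) (λ ne eq → ne (sym eq))
      ((λ { refl ne → ne }) , (λ { refl ne → ne })) (↭⇒↭ₛ p) sep

  valid-rotate : ∀ {x w} → Valid (x ∷ w) → Valid (w ∷ʳ anti x)
  valid-rotate {x} {w} (len , x-sep ∷ sep) = valid-↭ (∷↭∷ʳ (anti x) w)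
    (len , All.map (λ ne eq → ne (trans (sym (pairOf-anti x)) eq)) x-sep ∷ sep)

  valid-map : ∀ {h : V → V} → (∀ u → h (anti u) ≡ anti (h u)) → (∀ {u u′} → h u ≡ h u′ → u ≡ u′) →
    ∀ {w} → Valid w → Valid (map h w)
  valid-map {h} h-anti h-inj {w} (len , sep) = trans (length-map h w) len ,
    AllPairs.map⁺ (AllPairs.map (λ {u} {u′} ne eq → ne (pair-eq u u′ eq)) sep)
    where
    pair-eq : ∀ u u′ → pairOf (h u) ≡ pairOf (h u′) → pairOf u ≡ pairOf u′
    pair-eq u u′ eq with pairOf-≡ (h u) (h u′) eq
    ... | inj₁ e = cong pairOf (h-inj e)
    ... | inj₂ e = trans (cong pairOf (h-inj (trans e (sym (h-anti u′))))) (pairOf-anti u′)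

  standard : List V
  standard = map (combine {2} zero) (allFin n)

  standard-valid : Valid standard
  standard-valid = trans (length-map (combine {2} zero) (allFin n)) (length-tabulate {n = n} id) ,
    AllPairs.map⁺ (AllPairs.map (λ {i} {j} i≢j eq → i≢j (trans (sym (pair i)) (trans eq (pair j)))) (Unique.allFin⁺ n))
    where
    pair : ∀ i → pairOf (combine {2} zero i) ≡ i
    pair i = cong proj₂ (remQuot-combine {2} zero i)

  anti-anti : ∀ w → map anti (map anti w) ≡ w
  anti-anti w = trans (sym (map-∘ w)) (trans (map-cong anti-involutive w) (map-id w))

  cyc-antiperiodic : ∀ x w j → cyc (x ∷ w) (length (x ∷ w) + j) ≡ anti (cyc (x ∷ w) j)
  cyc-antiperiodic x w j = trans
    (trans (cong (λ l → cyc l (length (x ∷ w) + j)) (sym (++-identityʳ (x ∷ w)))) (cyc-rotate (x ∷ w) [] j))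
    (cyc-map (λ _ → refl) x w j)

  cyc-separated : ∀ {x w} → Valid (x ∷ w) → ∀ m → 0 < m → m < n → pairOf (cyc (x ∷ w) m) ≢ pairOf x
  cyc-separated {x} {w} (len , x-sep ∷ _) m 0<m m<n eq
    with split-at (x ∷ w) m (subst (m <_) (sym len) m<n)
  ... | [] , y , q , _ , refl = contradiction 0<m (<-irrefl refl)
  ... | _ ∷ p , y , q , refl , refl = All.lookup x-sep (∈-++⁺ʳ p (here refl))
    (sym (trans (cong pairOf (sym (cyc-at (x ∷ p) y q))) eq))

  -- In the first half the edge of x does not recur. In the second half it recurs only n places
  -- after the start, and there the letter is `anti x`.
  cyc-≢ : ∀ {x w} → Valid (x ∷ w) → ∀ m → 0 < m → m < N → cyc (x ∷ w) m ≢ x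
  cyc-≢ {x} {w} valid@(len , _) m 0<m m<N eq with m <? n
  ... | yes m<n = cyc-separated valid m 0<m m<n (cong pairOf eq)
  ... | no m≮n = second-half (m ∸ n) (m+[n∸m]≡n (≮⇒≥ m≮n))
    where
    second-half : ∀ m′ → n + m′ ≡ m → ⊥
    second-half m′ n+m′≡m with anti-eq ← trans (sym (cyc-antiperiodic x w m′))
                             (trans (cong (cyc (x ∷ w)) (trans (cong (_+ m′) len) n+m′≡m)) eq)
                          with m′
    ... | zero   = anti-≢ x anti-eq
    ... | suc m″ = cyc-separated valid (suc m″) z<s
      (+-cancelˡ-< n _ _ (subst (_< n + n) (sym n+m′≡m) (subst (m <_) N≡n+n m<N)))
      (trans (sym (pairOf-anti _)) (cong pairOf anti-eq))

  -- Rotating the word moves the starting point, so any position may be taken as position 0.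
  valid-shift : ∀ j x w → Valid (x ∷ w) →
    ∃[ y ] ∃[ w′ ] Valid (y ∷ w′) × (∀ i → cyc (x ∷ w) (j + i) ≡ cyc (y ∷ w′) i)
  valid-shift zero    x w       valid = x , w , valid , λ _ → refl
  valid-shift (suc j) x []      valid = valid-shift j (anti x) [] (valid-rotate valid)
  valid-shift (suc j) x (y ∷ w) valid = valid-shift j y (w ∷ʳ anti x) (valid-rotate valid)

  cyc-arrangement : ∀ {x w} → Valid (x ∷ w) → Arrangement (cyc (x ∷ w))
  cyc-arrangement {x} {w} valid@(len , _) = record
    { antiperiodic = λ j → trans (cong (λ l → cyc (x ∷ w) (l + j)) (sym len)) (cyc-antiperiodic x w j)
    ; injective    = inj
    }
    where
    inj : ∀ j m → 0 < m → m < N → cyc (x ∷ w) (j + m) ≢ cyc (x ∷ w) j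
    inj j m 0<m m<N eq with y , w′ , valid′ , eqs ← valid-shift j x w valid =
      cyc-≢ valid′ m 0<m m<N (trans (sym (eqs m)) (trans eq
        (trans (cong (cyc (x ∷ w)) (sym (+-identityʳ j))) (eqs 0))))

  module _ (pre : List V) (a b : V) (post : List V) (len : length (pre ++ a ∷ b ∷ post) ≡ n) where

    private
      i  = length pre
      w  = pre ++ a ∷ b ∷ post
      w′ = pre ++ b ∷ a ∷ post

    data MovedInWord (Y : ℕ) : ℕ → Set where
      fixed : MovedInWord Y Y
      up    : Y ≡ i → MovedInWord Y (suc Y)
      down  : ∀ {Z} → suc Z ≡ Y → Y ≡ suc i → MovedInWord Y Z

    private
      cyc-second : ∀ c e q → cyc (pre ++ c ∷ e ∷ q) (suc i) ≡ e
      cyc-second c e q = trans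
        (cong₂ cyc (sym (++-assoc pre [ c ] (e ∷ q))) (trans (+-comm 1 i) (sym (length-++ pre))))
        (cyc-at (pre ++ [ c ]) e q)

      cyc-later : ∀ c e j → j < length post → cyc (pre ++ c ∷ e ∷ post) (i + 2 + j) ≡ cyc (post ++ []) j
      cyc-later c e j j<post = begin
        cyc (pre ++ c ∷ e ∷ post) (i + 2 + j)
          ≡⟨ cong₂ cyc (sym (++-assoc pre (c ∷ e ∷ []) post)) (cong (_+ j) (sym (length-++ pre))) ⟩
        cyc ((pre ++ c ∷ e ∷ []) ++ post) (length (pre ++ c ∷ e ∷ []) + j)
          ≡⟨ cyc-rotate (pre ++ c ∷ e ∷ []) post j ⟩
        cyc (post ++ map anti (pre ++ c ∷ e ∷ [])) j
          ≡⟨ cyc-prefix post _ [] j j<post ⟩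
        cyc (post ++ []) j ∎
        where open ≡-Reasoning

    swap-in-word : ∀ Y → Y < n → ∃[ Z ] cyc w′ Y ≡ cyc w Z × MovedInWord Y Z
    swap-in-word Y Y<n with <-cmp Y i
    ... | tri< Y<i _ _  = Y , cyc-prefix pre _ _ Y Y<i , fixed
    ... | tri≈ _ refl _ = suc i , trans (cyc-at pre b _) (sym (cyc-second a b post)) , up refl
    ... | tri> _ _ i<Y with m≤n⇒m<n∨m≡n i<Y
    ... | inj₂ refl = i , trans (cyc-second b a post) (sym (cyc-at pre a _)) , down refl refl
    ... | inj₁ i+1<Y = Y , trans (cong (cyc w′) Y≡) (trans (trans (cyc-later b a e e<) (sym (cyc-later a b e e<)))
                             (cong (cyc w) (sym Y≡))) , fixed
      where
      e : ℕ
      e = Y ∸ (i + 2)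
      Y≡ : Y ≡ i + 2 + e
      Y≡ = sym (m+[n∸m]≡n (subst (_≤ Y) (+-comm 2 i) i+1<Y))
      e< : e < length post
      e< = +-cancelˡ-< (i + 2) _ _ (begin-strict
        i + 2 + e             ≡⟨ Y≡ ⟨
        Y                     <⟨ Y<n ⟩
        n                     ≡⟨ len ⟨
        length w              ≡⟨ length-++ pre ⟩
        i + (2 + length post) ≡⟨ +-assoc i 2 _ ⟨
        i + 2 + length post   ∎)
        where open ≤-Reasoning

    -- The second half of the cycle is the antipodal copy of the first, so a transposition in the
    -- word shows up again at n + i.
    cyc-swapped : Arrangement (cyc w) → Arrangement (cyc w′) → Swapped i (cyc w) (cyc w′)
    cyc-swapped arr arr′ Y _ Y<N with Y <? n
    ... | yes Y<n with swap-in-word Y Y<n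
    ...   | _ , eq , fixed         = Y , eq , fixed
    ...   | _ , eq , up at         = suc Y , eq , up (inj₁ at)
    ...   | Z , eq , down eqZ at   = Z , eq , down eqZ (inj₁ at)
    cyc-swapped arr arr′ Y _ Y<N | no Y≮n = second-half (Y ∸ n) (m+[n∸m]≡n (≮⇒≥ Y≮n))
      where
      second-half : ∀ Y′ → n + Y′ ≡ Y → ∃[ Z ] cyc w′ Y ≡ cyc w Z × Moved i Y Z
      second-half Y′ refl = conclude (swap-in-word Y′ (+-cancelˡ-< n _ _ (subst (n + Y′ <_) N≡n+n Y<N)))
        where
        shifted : ∀ {Z} → cyc w′ Y′ ≡ cyc w Z → cyc w′ (n + Y′) ≡ cyc w (n + Z)
        shifted eq = trans (antiperiodic arr′ Y′) (trans (cong anti eq) (sym (antiperiodic arr _)))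
        conclude : (∃[ Z ] cyc w′ Y′ ≡ cyc w Z × MovedInWord Y′ Z) → ∃[ Z ] cyc w′ (n + Y′) ≡ cyc w Z × Moved i (n + Y′) Z
        conclude (_ , eq , fixed)               = n + Y′ , shifted eq , fixed
        conclude (_ , eq , up at)               = suc (n + Y′) ,
          trans (shifted eq) (cong (cyc w) (+-suc n Y′)) , up (inj₂ (cong (n +_) at))
        conclude (Z , eq , down eqZ at)         = n + Z , shifted eq ,
          down (trans (sym (+-suc n Z)) (cong (n +_) eqZ)) (inj₂ (cong (n +_) at))

  -- A = (anti J) x P in the cyclic order x, P, R, J.
  arrange : ∀ {x w} → Valid (x ∷ w) → ∀ {A} → Independent (M n) A → x ∈ A →
    ∃[ w′ ] w ↭ w′ × ∃[ j ] arc (cyc (x ∷ w′)) j ∣ A ∣ ≡ A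
  arrange {x} {w} valid {A} indep x∈A = P ++ R ++ J , w↭ , length (x ∷ P ++ R) + n , arc≡A
    where
    P Q R J : List V
    -- Apart from x, a vertex of A is a letter of w, listed in P, or the antipode of a letter,
    -- listed in J. R holds the letters whose edges A misses.
    P = filter (_∈? A) w
    Q = filter (¬? ∘ (_∈? A)) w
    R = filter (¬? ∘ (λ y → anti y ∈? A)) Q
    J = filter (λ y → anti y ∈? A) Q

    w↭ : w ↭ P ++ R ++ J
    w↭ = ↭-trans (filter-++-¬ (_∈? A) w) (++⁺ˡ P (↭-trans (filter-++-¬ (λ y → anti y ∈? A) Q) (↭-++-comm J R)))

    v : ℕ → V
    v = cyc (x ∷ P ++ R ++ J)

    valid′ : Valid (x ∷ P ++ R ++ J)
    valid′ = valid-↭ (prep x w↭) valid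

    arr : Arrangement v
    arr = cyc-arrangement valid′

    letters : List V
    letters = map anti J ++ x ∷ P

    -- Two rotations: past x P R, which brings J to the front, and then by n, which inverts J and
    -- restores x P R behind it.
    v-letters : ∀ i → v (length (x ∷ P ++ R) + n + i) ≡ cyc (letters ++ R) i
    v-letters i = begin
      v (length L + n + i)                         ≡⟨ cong₂ cyc (cong (x ∷_) (sym (++-assoc P R J))) (+-assoc (length L) n i) ⟩
      cyc (L ++ J) (length L + (n + i))            ≡⟨ cyc-rotate L J (n + i) ⟩
      cyc (J ++ map anti L) (n + i)                ≡⟨ cong₂ (λ a b → cyc a (b + i)) (sym (++-identityʳ (J ++ map anti L))) (sym len) ⟩
      cyc ((J ++ map anti L) ++ []) (length (J ++ map anti L) + i) ≡⟨ cyc-rotate (J ++ map anti L) [] i ⟩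
      cyc (map anti (J ++ map anti L)) i           ≡⟨ cong (λ l → cyc l i) (map-++ anti J (map anti L)) ⟩
      cyc (map anti J ++ map anti (map anti L)) i  ≡⟨ cong (λ l → cyc (map anti J ++ l) i) (anti-anti L) ⟩
      cyc (map anti J ++ L) i                      ≡⟨ cong (λ l → cyc l i) (sym (++-assoc (map anti J) (x ∷ P) R)) ⟩
      cyc (letters ++ R) i                         ∎
      where
      open ≡-Reasoning
      L : List V
      L = x ∷ P ++ R
      len : length (J ++ map anti L) ≡ n
      len = begin
        length (J ++ map anti L)     ≡⟨ length-++ J ⟩
        length J + length (map anti L) ≡⟨ cong (length J +_) (length-map anti L) ⟩
        length J + length L          ≡⟨ +-comm (length J) (length L) ⟩
        length L + length J          ≡⟨ length-++ L ⟨
        length (L ++ J)              ≡⟨ cong (λ l → length (x ∷ l)) (++-assoc P R J) ⟩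
        length (x ∷ P ++ R ++ J)     ≡⟨ proj₁ valid′ ⟩
        n                            ∎

    -- The n letters lie on n distinct edges, hence on all of them.
    pairs : ∀ u → u ∈ₗ x ∷ w ⊎ anti u ∈ₗ x ∷ w
    pairs u with ∈-map⁻ pairOf (unique-⊆-reverse {ys = allFin n} (AllPairs.map⁺ (proj₂ valid)) (λ _ → ∈-allFin _)
               (≤-reflexive (trans (length-tabulate {n = n} id) (sym (trans (length-map pairOf (x ∷ w)) (proj₁ valid)))))
               (∈-allFin (pairOf u)))
    ... | y , y∈ , eq with pairOf-≡ y u (sym eq)
    ...   | inj₁ y≡u = inj₁ (subst (_∈ₗ x ∷ w) y≡u y∈)
    ...   | inj₂ y≡  = inj₂ (subst (_∈ₗ x ∷ w) y≡ y∈)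

    not-both : ∀ {u} → u ∈ A → anti u ∈ A → ⊥
    not-both {u} u∈ au∈ = indep u∈ au∈ (adj-anti u)

    A⊆ : ∀ {u} → u ∈ A → u ∈ₗ letters
    A⊆ {u} u∈ with pairs u
    ... | inj₁ (here refl) = ∈-++⁺ʳ (map anti J) (here refl)
    ... | inj₁ (there u∈w) = ∈-++⁺ʳ (map anti J) (there (∈-filter⁺ (_∈? A) u∈w u∈))
    ... | inj₂ (here au≡x) = ⊥-elim (not-both u∈ (subst (_∈ A) (sym au≡x) x∈A))
    ... | inj₂ (there au∈w) = ∈-++⁺ˡ (subst (_∈ₗ map anti J) (anti-involutive u) (∈-map⁺ anti
            (∈-filter⁺ (λ y → anti y ∈? A) (∈-filter⁺ (¬? ∘ (_∈? A)) au∈w (not-both u∈))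
              (subst (_∈ A) (sym (anti-involutive u)) u∈))))

    ⊆A : ∀ {u} → u ∈ₗ letters → u ∈ A
    ⊆A u∈ with ∈-++⁻ (map anti J) u∈
    ... | inj₁ u∈J with y , y∈J , refl ← ∈-map⁻ anti u∈J = proj₂ (∈-filter⁻ (λ y → anti y ∈? A) {xs = Q} y∈J)
    ... | inj₂ (here refl)  = x∈A
    ... | inj₂ (there u∈P)  = proj₂ (∈-filter⁻ (_∈? A) {xs = w} u∈P)

    j : ℕ
    j = length (x ∷ P ++ R) + n

    arc≡ : arc v j (length letters) ≡ A
    arc≡ = begin
      arc v j (length letters)                     ≡⟨ arc-cong v (cyc (letters ++ R)) j 0 (length letters) v-letters ⟩
      setOf (applyUpTo (cyc (letters ++ R)) (length letters)) ≡⟨ cong setOf (applyUpTo-cyc letters R) ⟩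
      setOf letters                                ≡⟨ ⊆-antisym (⊆A ∘ ∈-setOf⁻ letters) (∈-setOf⁺ ∘ A⊆) ⟩
      A                                            ∎
      where open ≡-Reasoning

    len≤N : length letters ≤ N
    len≤N = begin
      length letters                    ≡⟨ length-++ (map anti J) ⟩
      length (map anti J) + suc (length P) ≡⟨ cong (_+ suc (length P)) (length-map anti J) ⟩
      length J + suc (length P)         ≤⟨ m≤n+m _ (length R) ⟩
      length R + (length J + suc (length P)) ≡⟨ +-assoc (length R) _ _ ⟨
      length R + length J + suc (length P) ≡⟨ +-comm _ (suc (length P)) ⟩
      suc (length P + (length R + length J)) ≡⟨ cong (λ l → suc (length P + l)) (length-++ R) ⟨
      suc (length P + length (R ++ J))  ≡⟨ cong suc (length-++ P) ⟨
      suc (length (P ++ R ++ J))        ≡⟨ proj₁ valid′ ⟩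
      n                                 ≤⟨ m≤m+n n _ ⟩
      N                                 ∎
      where open ≤-Reasoning

    arc≡A : arc v j ∣ A ∣ ≡ A
    arc≡A = subst (λ l → arc v j l ≡ A) (trans (sym (∣arc∣ arr j len≤N)) (cong ∣_∣ arc≡)) arc≡

-- Averaging over all arrangements

∑ : ∀ {a} {A : Set a} → List A → (A → ℕ) → ℕ
∑ xs f = sum (map f xs)

module _ {a} {A : Set a} where

  ∑-cong : ∀ (xs : List A) {f g} → (∀ {x} → x ∈ₗ xs → f x ≡ g x) → ∑ xs f ≡ ∑ xs g
  ∑-cong []       _   = refl
  ∑-cong (x ∷ xs) f≡g = cong₂ _+_ (f≡g (here refl)) (∑-cong xs (f≡g ∘ there))

  ∑-mono : ∀ (xs : List A) {f g} → (∀ {x} → x ∈ₗ xs → f x ≤ g x) → ∑ xs f ≤ ∑ xs g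
  ∑-mono []       _   = z≤n
  ∑-mono (x ∷ xs) f≤g = +-mono-≤ (f≤g (here refl)) (∑-mono xs (f≤g ∘ there))

  ∑-const : ∀ (xs : List A) c → ∑ xs (λ _ → c) ≡ length xs * c
  ∑-const []       c = refl
  ∑-const (x ∷ xs) c = cong (c +_) (∑-const xs c)

  ∑-+ : ∀ (xs : List A) f g → ∑ xs (λ x → f x + g x) ≡ ∑ xs f + ∑ xs g
  ∑-+ []       f g = refl
  ∑-+ (x ∷ xs) f g = trans (cong (f x + g x +_) (∑-+ xs f g))
    (solve 4 (λ a b c d → a :+ b :+ (c :+ d) := a :+ c :+ (b :+ d)) refl (f x) (g x) _ _)
    where open +-*-Solver

  ∑-squeeze : ∀ (xs : List A) {f g} → (∀ {x} → x ∈ₗ xs → f x ≤ g x) → ∑ xs f ≡ ∑ xs g →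
    ∀ {x} → x ∈ₗ xs → f x ≡ g x
  ∑-squeeze (x ∷ xs) f≤g eq (here refl) = proj₁ (+-squeeze (f≤g (here refl)) (∑-mono xs (f≤g ∘ there)) eq)
  ∑-squeeze (x ∷ xs) f≤g eq (there y∈)  = ∑-squeeze xs (f≤g ∘ there)
    (proj₂ (+-squeeze (f≤g (here refl)) (∑-mono xs (f≤g ∘ there)) eq)) y∈

  Σ<-∑ : ∀ n (xs : List A) (f : ℕ → A → ℕ) → Σ< n (λ j → ∑ xs (f j)) ≡ ∑ xs (λ x → Σ< n (λ j → f j x))
  Σ<-∑ n []       f = trans (Σ<-const n 0) (*-zeroʳ n)
  Σ<-∑ n (x ∷ xs) f = trans (Σ<-+ n (λ j → f j x) (λ j → ∑ xs (f j)))
    (cong (Σ< n (λ j → f j x) +_) (Σ<-∑ n xs f))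

∑-swap : ∀ {a b} {A : Set a} {B : Set b} (xs : List A) (ys : List B) (f : A → B → ℕ) →
  ∑ xs (λ x → ∑ ys (f x)) ≡ ∑ ys (λ y → ∑ xs (λ x → f x y))
∑-swap []       ys f = sym (trans (∑-const ys 0) (*-zeroʳ (length ys)))
∑-swap (x ∷ xs) ys f = trans (cong (∑ ys (f x) +_) (∑-swap xs ys f)) (sym (∑-+ ys (f x) _))

module _ {m : ℕ} where

  count-∉ : ∀ (A : Subset m) (G : Family m) → ¬ (A ∈ᶠ G) → ∑ G (λ B → ⟦ does (A ≟ˢ B) ⟧) ≡ 0
  count-∉ A []      _   = refl
  count-∉ A (B ∷ G) A∉G = cong₂ _+_ (cong ⟦_⟧ (dec-false (A ≟ˢ B) (A∉G ∘ here))) (count-∉ A G (A∉G ∘ there))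

  count-∈ : ∀ (A : Subset m) {G : Family m} → Unique G → A ∈ᶠ G → ∑ G (λ B → ⟦ does (A ≟ˢ B) ⟧) ≡ 1
  count-∈ A {B ∷ G} (B∉G ∷ _) (here refl) = cong₂ _+_ (cong ⟦_⟧ (dec-true (A ≟ˢ A) refl)) (count-∉ A G (All¬⇒¬Any B∉G))
  count-∈ A {B ∷ G} (B∉G ∷ uG) (there A∈G) = cong₂ _+_
    (cong ⟦_⟧ (dec-false (A ≟ˢ B) λ { refl → All¬⇒¬Any B∉G A∈G })) (count-∈ A uG A∈G)

  count-member : ∀ (A : Subset m) {G : Family m} → Unique G → ⟦ does (A ∈ᶠ? G) ⟧ ≡ ∑ G (λ B → ⟦ does (A ≟ˢ B) ⟧)
  count-member A {G} uG with A ∈ᶠ? G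
  ... | yes A∈G = sym (count-∈ A uG A∈G)
  ... | no A∉G  = sym (count-∉ A G A∉G)

module Counting (n : ℕ) (d : Fin (2 * n)) where
  open Antipode n
  open Words n d

  instance
    N≢0 : NonZero N
    N≢0 = nonZeroIndex d

  n≢0 : n ≢ 0
  n≢0 n≡0 = ≢-nonZero⁻¹ N (cong (2 *_) n≡0)

  periodic* : ∀ {v} → Arrangement v → ∀ q i → v (i + q * N) ≡ v i
  periodic* {v} arr zero    i = cong v (+-identityʳ i)
  periodic* {v} arr (suc q) i = trans
    (cong v (trans (cong (i +_) (+-comm N (q * N))) (sym (+-assoc i (q * N) N))))
    (trans (periodic arr (i + q * N)) (periodic* arr q i))

  mod-N : ∀ {v} → Arrangement v → ∀ j → v j ≡ v (j % N)
  mod-N {v} arr j = trans (cong v (m≡m%n+[m/n]*n j N)) (periodic* arr (j / N) (j % N))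

  arc-mod : ∀ {v} → Arrangement v → ∀ j ℓ → arc v j ℓ ≡ arc v (j % N) ℓ
  arc-mod {v} arr j ℓ = arc-cong v v j (j % N) ℓ λ i → trans
    (cong v (trans (cong (_+ i) (m≡m%n+[m/n]*n j N)) (reassoc (j % N) (j / N * N) i))) (periodic* arr (j / N) (j % N + i))
    where
    reassoc : ∀ a b c → a + b + c ≡ a + c + b
    reassoc a b c = trans (+-assoc a b c) (trans (cong (a +_) (+-comm b c)) (sym (+-assoc a c b)))

  -- Positions of an arrangement carry the same vertex just when they are congruent modulo N, a
  -- condition that does not depend on the arrangement. This makes `transfer` well defined and
  -- injective.
  transfer-≡ : ∀ {v w} → Arrangement v → Arrangement w → ∀ {i j} → v i ≡ v j → w i ≡ w j
  transfer-≡ {v} {w} arr arr′ {i} {j} eq = trans (mod-N arr′ i) (trans (cong w same) (sym (mod-N arr′ j)))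
    where
    eq% : v (i % N) ≡ v (j % N)
    eq% = trans (sym (mod-N arr i)) (trans eq (mod-N arr j))
    same : i % N ≡ j % N
    same with <-cmp (i % N) (j % N)
    ... | tri< lt _ _ = contradiction eq% (distinct arr 0 lt (m%n<n j N))
    ... | tri≈ _ e _  = e
    ... | tri> _ _ gt = contradiction (sym eq%) (distinct arr 0 gt (m%n<n i N))

  -- The arrangements form a torsor under the signed permutations of the vertices.
  module _ {v w : ℕ → V} (arr : Arrangement v) (arr′ : Arrangement w) where

    transfer : V → V
    transfer u = w (proj₁ (surjective arr u))

    transfer-at : ∀ j → transfer (v j) ≡ w j
    transfer-at j = transfer-≡ arr arr′ (sym (proj₂ (proj₂ (surjective arr (v j)))))

    transfer-anti : ∀ u → transfer (anti u) ≡ anti (transfer u)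
    transfer-anti u = from-position (surjective arr u)
      where
      open ≡-Reasoning
      from-position : (∃[ j ] j < N × u ≡ v j) → transfer (anti u) ≡ anti (transfer u)
      from-position (j , _ , u≡) = begin
        transfer (anti u)      ≡⟨ cong (transfer ∘ anti) u≡ ⟩
        transfer (anti (v j))  ≡⟨ cong transfer (antiperiodic arr j) ⟨
        transfer (v (n + j))   ≡⟨ transfer-at (n + j) ⟩
        w (n + j)              ≡⟨ antiperiodic arr′ j ⟩
        anti (w j)             ≡⟨ cong anti (transfer-at j) ⟨
        anti (transfer (v j))  ≡⟨ cong (anti ∘ transfer) u≡ ⟨
        anti (transfer u)      ∎

    transfer-injective : ∀ {u u′} → transfer u ≡ transfer u′ → u ≡ u′
    transfer-injective {u} {u′} eq = trans (position u) (trans (transfer-≡ arr′ arr eq) (sym (position u′)))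
      where
      position : ∀ u → u ≡ v (proj₁ (surjective arr u))
      position u = proj₂ (proj₂ (surjective arr u))

  module _ (h : V → V) (v v′ : ℕ → V) (j j′ ℓ : ℕ) where

    arc-image : arc v j ℓ ⊆ arc v′ j′ ℓ → arc (h ∘ v) j ℓ ⊆ arc (h ∘ v′) j′ ℓ
    arc-image sub u∈ with i , i<ℓ , refl ← ∈-arc⁻ (h ∘ v) j ℓ u∈
                     with i′ , i′<ℓ , eq ← ∈-arc⁻ v′ j′ ℓ (sub (∈-arc⁺ v j i<ℓ)) =
      subst (_∈ arc (h ∘ v′) j′ ℓ) (cong h (sym eq)) (∈-arc⁺ (h ∘ v′) j′ i′<ℓ)

    arc-image⁻ : (∀ {u u′} → h u ≡ h u′ → u ≡ u′) →
      arc (h ∘ v) j ℓ ⊆ arc (h ∘ v′) j′ ℓ → arc v j ℓ ⊆ arc v′ j′ ℓ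
    arc-image⁻ h-inj sub u∈ with i , i<ℓ , refl ← ∈-arc⁻ v j ℓ u∈
                            with i′ , i′<ℓ , eq ← ∈-arc⁻ (h ∘ v′) j′ ℓ (sub (∈-arc⁺ (h ∘ v) j i<ℓ)) =
      subst (_∈ arc v′ j′ ℓ) (sym (h-inj eq)) (∈-arc⁺ v′ j′ i′<ℓ)

  lists : ℕ → List (List V)
  lists zero    = [] ∷ []
  lists (suc m) = cartesianProductWith _∷_ (allFin N) (lists m)

  lists-unique : ∀ m → Unique (lists m)
  lists-unique zero    = [] ∷ []
  lists-unique (suc m) = Unique.cartesianProductWith⁺ _∷_ ∷-injective (Unique.allFin⁺ N) (lists-unique m)

  ∈-lists : ∀ w → w ∈ₗ lists (length w)
  ∈-lists []      = here refl
  ∈-lists (x ∷ w) = ∈-cartesianProductWith⁺ _∷_ (∈-allFin x) (∈-lists w)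

  arrangements : List (List V)
  arrangements = filter valid? (lists n)

  arrangements-unique : Unique arrangements
  arrangements-unique = Unique.filter⁺ valid? (lists-unique n)

  ∈-arrangements⁺ : ∀ {w} → Valid w → w ∈ₗ arrangements
  ∈-arrangements⁺ {w} valid = ∈-filter⁺ valid? (subst (λ m → w ∈ₗ lists m) (proj₁ valid) (∈-lists w)) valid

  ∈-arrangements⁻ : ∀ {w} → w ∈ₗ arrangements → Valid w
  ∈-arrangements⁻ w∈ = proj₂ (∈-filter⁻ valid? {xs = lists n} w∈)

  -- Relabelling by a signed permutation h is an injection of the finite set of valid words into
  -- itself, hence a permutation of it.
  arrangements-map : ∀ {h : V → V} → (∀ u → h (anti u) ≡ anti (h u)) → (∀ {u u′} → h u ≡ h u′ → u ≡ u′) →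
    map (map h) arrangements ↭ arrangements
  arrangements-map {h} h-anti h-inj = ∼bag⇒↭ (unique∧set⇒bag unique-map arrangements-unique (mk⇔ ⊆₁ ⊆₂))
    where
    unique-map : Unique (map (map h) arrangements)
    unique-map = Unique.map⁺ (map-injective h-inj) arrangements-unique
    ⊆₁ : ∀ {w} → w ∈ₗ map (map h) arrangements → w ∈ₗ arrangements
    ⊆₁ w∈ with w′ , w′∈ , refl ← ∈-map⁻ (map h) w∈ = ∈-arrangements⁺ (valid-map h-anti h-inj (∈-arrangements⁻ w′∈))
    ⊆₂ : ∀ {w} → w ∈ₗ arrangements → w ∈ₗ map (map h) arrangements
    ⊆₂ = unique-⊆-reverse unique-map ⊆₁ (≤-reflexive (sym (length-map (map h) arrangements)))

  valid-∷ : ∀ {w} → Valid w → ∃[ x ] ∃[ w′ ] w ≡ x ∷ w′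
  valid-∷ {[]}    (len , _) = contradiction (sym len) n≢0
  valid-∷ {x ∷ w} _         = x , w , refl

  valid⇒arrangement : ∀ {w} → Valid w → Arrangement (cyc w)
  valid⇒arrangement valid with _ , _ , refl ← valid-∷ valid = cyc-arrangement valid

  module _ (r : ℕ) where

    opaque

      occurrences : Subset N → ℕ
      occurrences A = ∑ arrangements (λ w → Σ< N (λ j → ⟦ does (arc (cyc w) j r ≟ˢ A) ⟧))

      double-count : ∀ {G : Family N} → Unique G →
        ∑ arrangements (λ w → Σ< N (λ j → ⟦ does (arc (cyc w) j r ∈ᶠ? G) ⟧)) ≡ ∑ G occurrences
      double-count {G} uG = begin
        ∑ arrangements (λ w → Σ< N (λ j → ⟦ does (arc (cyc w) j r ∈ᶠ? G) ⟧))
          ≡⟨ ∑-cong arrangements (λ {w} _ → trans (Σ<-cong N λ j _ → count-member (arc (cyc w) j r) uG)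
                                                  (Σ<-∑ N G (λ j B → ⟦ does (arc (cyc w) j r ≟ˢ B) ⟧))) ⟩
        ∑ arrangements (λ w → ∑ G (λ B → Σ< N (λ j → ⟦ does (arc (cyc w) j r ≟ˢ B) ⟧)))
          ≡⟨ ∑-swap arrangements G _ ⟩
        ∑ G occurrences ∎
        where open ≡-Reasoning

      -- The signed permutation that carries the first arrangement to the second takes one arc to
      -- the other and only permutes the summands.
      occurrences-const : ∀ {v w} → Valid v → Valid w → occurrences (arc (cyc v) 0 r) ≡ occurrences (arc (cyc w) 0 r)
      occurrences-const {v} {w} valid valid′ = begin
        ∑ arrangements (at (arc (cyc v) 0 r))
          ≡⟨ ∑-cong arrangements (λ {u} u∈ → Σ<-cong N λ j _ → cong ⟦_⟧ (pointwise (∈-arrangements⁻ u∈) j)) ⟩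
        ∑ arrangements (at (arc (cyc w) 0 r) ∘ map h)
          ≡⟨ cong sum (map-∘ arrangements) ⟩
        ∑ (map (map h) arrangements) (at (arc (cyc w) 0 r))
          ≡⟨ sum-↭ (↭-map⁺ (at (arc (cyc w) 0 r)) (arrangements-map h-anti h-inj)) ⟩
        ∑ arrangements (at (arc (cyc w) 0 r)) ∎
        where
        open ≡-Reasoning
        at : Subset N → List V → ℕ
        at A u = Σ< N (λ j → ⟦ does (arc (cyc u) j r ≟ˢ A) ⟧)
        arr : Arrangement (cyc v)
        arr = valid⇒arrangement valid
        arr′ : Arrangement (cyc w)
        arr′ = valid⇒arrangement valid′
        h : V → V
        h = transfer arr arr′
        h-anti : ∀ u → h (anti u) ≡ anti (h u)
        h-anti = transfer-anti arr arr′
        h-inj : ∀ {u u′} → h u ≡ h u′ → u ≡ u′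
        h-inj = transfer-injective arr arr′
        image-w : arc (h ∘ cyc v) 0 r ≡ arc (cyc w) 0 r
        image-w = arc-cong (h ∘ cyc v) (cyc w) 0 0 r (transfer-at arr arr′)
        pointwise : ∀ {u} → Valid u → ∀ j →
          does (arc (cyc u) j r ≟ˢ arc (cyc v) 0 r) ≡ does (arc (cyc (map h u)) j r ≟ˢ arc (cyc w) 0 r)
        pointwise {u} valid-u j with x , u′ , refl ← valid-∷ valid-u = does-⇔ (mk⇔ to from) (_ ≟ˢ _) (_ ≟ˢ _)
          where
          cu : ℕ → V
          cu = cyc (x ∷ u′)
          image-u : arc (cyc (map h (x ∷ u′))) j r ≡ arc (h ∘ cu) j r
          image-u = arc-cong (cyc (map h (x ∷ u′))) (h ∘ cu) j j r (λ i → cyc-map h-anti x u′ (j + i))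
          to : arc (cu) j r ≡ arc (cyc v) 0 r → arc (cyc (map h (x ∷ u′))) j r ≡ arc (cyc w) 0 r
          to eq = trans image-u (trans (⊆-antisym (arc-image h cu (cyc v) j 0 r (⊆-reflexive eq)) (arc-image h (cyc v) cu 0 j r (⊆-reflexive (sym eq)))) image-w)
          from : arc (cyc (map h (x ∷ u′))) j r ≡ arc (cyc w) 0 r → arc (cu) j r ≡ arc (cyc v) 0 r
          from eq = ⊆-antisym (arc-image⁻ h cu (cyc v) j 0 r h-inj (⊆-reflexive eq′)) (arc-image⁻ h (cyc v) cu 0 j r h-inj (⊆-reflexive (sym eq′)))
            where
            eq′ : arc (h ∘ cu) j r ≡ arc (h ∘ cyc v) 0 r
            eq′ = trans (sym image-u) (trans eq (sym image-w))

-- The size of 𝓟^r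

nC0≡1 : ∀ n → n C 0 ≡ 1
nC0≡1 n = trans (nCk≡nC[n∸k] {0} {n} z≤n) (nCn≡1 n)

-- The absorption identity: both sides count subsets of size k + 1 with one marked element. The
-- induction is Pascal's rule.
[k+1]*[n+1]C[k+1] : ∀ n k → suc k * (suc n C suc k) ≡ suc n * (n C k)
[k+1]*[n+1]C[k+1] zero zero    = refl
[k+1]*[n+1]C[k+1] zero (suc k) = begin
  suc (suc k) * (1 C suc (suc k)) ≡⟨ cong (suc (suc k) *_) (k>n⇒nCk≡0 {1} {suc (suc k)} (s≤s (s≤s z≤n))) ⟩
  suc (suc k) * 0                 ≡⟨ *-zeroʳ (suc (suc k)) ⟩
  0                               ≡⟨ cong (1 *_) (k>n⇒nCk≡0 {0} {suc k} z<s) ⟨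
  1 * (0 C suc k)                 ∎
  where open ≡-Reasoning
[k+1]*[n+1]C[k+1] (suc n) zero = begin
  1 * (suc (suc n) C 1)               ≡⟨ *-identityˡ _ ⟩
  suc (suc n) C 1                     ≡⟨ nCk+nC[k+1]≡[n+1]C[k+1] (suc n) 0 ⟨
  suc n C 0 + suc n C 1               ≡⟨ cong₂ _+_ (nC0≡1 (suc n)) (trans (sym (*-identityˡ _)) ([k+1]*[n+1]C[k+1] n zero)) ⟩
  1 + suc n * (n C 0)                 ≡⟨ cong (λ c → 1 + suc n * c) (nC0≡1 n) ⟩
  1 + suc n * 1                       ≡⟨ cong (λ c → suc (suc n) * c) (nC0≡1 (suc n)) ⟨
  suc (suc n) * (suc n C 0)           ∎
  where open ≡-Reasoning
[k+1]*[n+1]C[k+1] (suc n) (suc k) = begin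
  suc (suc k) * (suc (suc n) C suc (suc k))
    ≡⟨ cong (suc (suc k) *_) (nCk+nC[k+1]≡[n+1]C[k+1] (suc n) (suc k)) ⟨
  suc (suc k) * (p + q)
    ≡⟨ solve 3 (λ k p q → (con 1 :+ k) :* (p :+ q) := p :+ k :* p :+ (con 1 :+ k) :* q) refl (suc k) p q ⟩
  p + suc k * p + suc (suc k) * q
    ≡⟨ cong₂ (λ a b → p + a + b) ([k+1]*[n+1]C[k+1] n k) ([k+1]*[n+1]C[k+1] n (suc k)) ⟩
  p + suc n * (n C k) + suc n * (n C suc k)
    ≡⟨ solve 4 (λ n p a b → p :+ n :* a :+ n :* b := p :+ n :* (a :+ b)) refl (suc n) p (n C k) (n C suc k) ⟩
  p + suc n * (n C k + n C suc k)
    ≡⟨ cong (λ c → p + suc n * c) (nCk+nC[k+1]≡[n+1]C[k+1] n k) ⟩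
  suc (suc n) * p ∎
  where
  open ≡-Reasoning
  open +-*-Solver
  p q : ℕ
  p = suc n C suc k
  q = suc n C suc (suc k)

-- One entry per edge: an independent set takes its first end, its second end or neither.
SignVec : ℕ → Set
SignVec = Vec (Maybe Bool)

support : ∀ {m} → SignVec m → ℕ
support []            = 0
support (nothing ∷ t) = support t
support (just _ ∷ t)  = suc (support t)

support≤ : ∀ {m} (t : SignVec m) → support t ≤ m
support≤ []            = z≤n
support≤ (nothing ∷ t) = m≤n⇒m≤1+n (support≤ t)
support≤ (just _ ∷ t)  = s≤s (support≤ t)

signVecs : ∀ m → ℕ → List (SignVec m)
signVecs zero    zero    = [] ∷ []
signVecs zero    (suc s) = []
signVecs (suc m) zero    = map (nothing ∷_) (signVecs m zero)
signVecs (suc m) (suc s) = map (nothing ∷_) (signVecs m (suc s))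
  ++ map (just true ∷_) (signVecs m s) ++ map (just false ∷_) (signVecs m s)

-- Pascal's rule, with a factor 2 for the sign of a new nonempty entry.
length-signVecs : ∀ m s → length (signVecs m s) ≡ 2 ^ s * (m C s)
length-signVecs zero    zero    = refl
length-signVecs zero    (suc s) = sym (trans (cong (2 ^ suc s *_) (k>n⇒nCk≡0 {0} {suc s} z<s)) (*-zeroʳ (2 ^ suc s)))
length-signVecs (suc m) zero    = trans (length-map _ (signVecs m zero))
  (trans (length-signVecs m zero) (cong (1 *_) (trans (nC0≡1 m) (sym (nC0≡1 (suc m))))))
length-signVecs (suc m) (suc s) = begin
  length (signVecs (suc m) (suc s))
    ≡⟨ trans (length-++ (map (nothing ∷_) (signVecs m (suc s)))) (cong₂ _+_ (length-map _ (signVecs m (suc s)))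
         (trans (length-++ (map (just true ∷_) (signVecs m s))) (cong₂ _+_ (length-map _ (signVecs m s)) (length-map _ (signVecs m s))))) ⟩
  length (signVecs m (suc s)) + (length (signVecs m s) + length (signVecs m s))
    ≡⟨ cong₂ (λ a b → a + (b + b)) (length-signVecs m (suc s)) (length-signVecs m s) ⟩
  2 * 2 ^ s * (m C suc s) + (2 ^ s * (m C s) + 2 ^ s * (m C s))
    ≡⟨ solve 3 (λ p a b → con 2 :* p :* a :+ (p :* b :+ p :* b) := con 2 :* p :* (b :+ a)) refl (2 ^ s) (m C suc s) (m C s) ⟩
  2 * 2 ^ s * (m C s + m C suc s)
    ≡⟨ cong (2 * 2 ^ s *_) (nCk+nC[k+1]≡[n+1]C[k+1] m s) ⟩
  2 ^ suc s * (suc m C suc s) ∎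
  where
  open ≡-Reasoning
  open +-*-Solver

∈-signVecs : ∀ {m} (t : SignVec m) → t ∈ₗ signVecs m (support t)
∈-signVecs []                 = here refl
∈-signVecs {suc m} (nothing ∷ t) with support t | ∈-signVecs t
... | zero  | t∈ = ∈-map⁺ (nothing ∷_) t∈
... | suc s | t∈ = ∈-++⁺ˡ (∈-map⁺ (nothing ∷_) t∈)
∈-signVecs {suc m} (just true ∷ t)  = ∈-++⁺ʳ (map (nothing ∷_) (signVecs m (suc (support t))))
  (∈-++⁺ˡ (∈-map⁺ (just true ∷_) (∈-signVecs t)))
∈-signVecs {suc m} (just false ∷ t) = ∈-++⁺ʳ (map (nothing ∷_) (signVecs m (suc (support t))))
  (∈-++⁺ʳ (map (just true ∷_) (signVecs m (support t))) (∈-map⁺ (just false ∷_) (∈-signVecs t)))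

signVecs-support : ∀ m s {t} → t ∈ₗ signVecs m s → support t ≡ s
signVecs-support zero    zero    (here refl) = refl
signVecs-support (suc m) zero    t∈ with _ , t′∈ , refl ← ∈-map⁻ (nothing ∷_) t∈ = signVecs-support m zero t′∈
signVecs-support (suc m) (suc s) t∈ with ∈-++⁻ (map (nothing ∷_) (signVecs m (suc s))) t∈
... | inj₁ t∈₁ with _ , t′∈ , refl ← ∈-map⁻ (nothing ∷_) t∈₁ = signVecs-support m (suc s) t′∈
... | inj₂ t∈₂ with ∈-++⁻ (map (just true ∷_) (signVecs m s)) t∈₂
...   | inj₁ t∈₃ with _ , t′∈ , refl ← ∈-map⁻ (just true ∷_) t∈₃ = cong suc (signVecs-support m s t′∈)
...   | inj₂ t∈₃ with _ , t′∈ , refl ← ∈-map⁻ (just false ∷_) t∈₃ = cong suc (signVecs-support m s t′∈)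

signVecs-unique : ∀ m s → Unique (signVecs m s)
signVecs-unique zero    zero    = [] ∷ []
signVecs-unique zero    (suc s) = []
signVecs-unique (suc m) zero    = Unique.map⁺ Vec.∷-injectiveʳ (signVecs-unique m zero)
signVecs-unique (suc m) (suc s) =
  Unique.++⁺ (Unique.map⁺ Vec.∷-injectiveʳ (signVecs-unique m (suc s)))
    (Unique.++⁺ (Unique.map⁺ Vec.∷-injectiveʳ (signVecs-unique m s)) (Unique.map⁺ Vec.∷-injectiveʳ (signVecs-unique m s))
      (λ (t∈ , t∈′) → heads (λ ()) t∈ t∈′))
    (λ (t∈ , t∈′) → [ heads (λ ()) t∈ , heads (λ ()) t∈ ]′ (∈-++⁻ (map (just true ∷_) (signVecs m s)) t∈′))
  where
  heads : ∀ {a b} {xs ys : List (SignVec m)} {t} → a ≢ b → t ∈ₗ map (a ∷_) xs → t ∈ₗ map (b ∷_) ys → ⊥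
  heads {a} {b} a≢b t∈ t∈′ with _ , _ , refl ← ∈-map⁻ (a ∷_) t∈ | _ , _ , eq ← ∈-map⁻ (b ∷_) t∈′ =
    a≢b (Vec.∷-injectiveˡ eq)

positive negative : Maybe Bool → Bool
positive (just true)  = true
positive _            = false
negative (just false) = true
negative _            = false

-- An edge with both ends present is read as its first end, so decoding and encoding again returns
-- only independent sets unchanged.
code : Bool → Bool → Maybe Bool
code true  _     = just true
code false true  = just false
code false false = nothing

∣++∣ : ∀ {a b} (p : Subset a) (q : Subset b) → ∣ p Vec.++ q ∣ ≡ ∣ p ∣ + ∣ q ∣
∣++∣ []          q = refl
∣++∣ (true ∷ p)  q = cong suc (∣++∣ p q)
∣++∣ (false ∷ p) q = ∣++∣ p q

∁-involutive : ∀ {m} (p : Subset m) → ∁ (∁ p) ≡ p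
∁-involutive p = ⊆-antisym
  (λ {x} x∈ → [ id , (λ x∉ → contradiction (x∉p⇒x∈∁p x∉) (x∈∁p⇒x∉p x∈)) ]′ (∈-or-∉ x))
  (λ x∈ → x∉p⇒x∈∁p (x∈p⇒x∉∁p x∈))
  where
  ∈-or-∉ : ∀ x → x ∈ p ⊎ x ∉ p
  ∈-or-∉ x with x ∈? p
  ... | yes x∈ = inj₁ x∈
  ... | no x∉  = inj₂ x∉

module Layers (n : ℕ) where
  open Antipode n

  -- The trailing empty vector matches `2 * n`, which unfolds to `n + (n + 0)`.
  toSet : SignVec n → Subset N
  toSet t = Vec.map positive t Vec.++ (Vec.map negative t Vec.++ [])

  fromSet : Subset N → SignVec n
  fromSet S = Vec.zipWith code (Vec.take n S) (Vec.take n (Vec.drop n S))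

  ∣toSet∣ : ∀ t → ∣ toSet t ∣ ≡ support t
  ∣toSet∣ t = trans (∣++∣ (Vec.map positive t) _) (trans (cong (∣ Vec.map positive t ∣ +_)
    (trans (∣++∣ (Vec.map negative t) []) (+-identityʳ _))) (halves t))
    where
    halves : ∀ {m} (t : SignVec m) → ∣ Vec.map positive t ∣ + ∣ Vec.map negative t ∣ ≡ support t
    halves []               = refl
    halves (nothing ∷ t)    = halves t
    halves (just true ∷ t)  = cong suc (halves t)
    halves (just false ∷ t) = trans (+-suc _ _) (cong suc (halves t))

  private
    take-++ : ∀ {a b} (p : Vec Bool a) (q : Vec Bool b) → Vec.take a (p Vec.++ q) ≡ p
    take-++ []      q = refl
    take-++ (x ∷ p) q = cong (x ∷_) (take-++ p q)

    drop-++ : ∀ {a b} (p : Vec Bool a) (q : Vec Bool b) → Vec.drop a (p Vec.++ q) ≡ q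
    drop-++ []      q = refl
    drop-++ (x ∷ p) q = drop-++ p q

    decode : ∀ {m} (t : SignVec m) → Vec.zipWith code (Vec.map positive t) (Vec.map negative t) ≡ t
    decode []               = refl
    decode (nothing ∷ t)    = cong (nothing ∷_) (decode t)
    decode (just true ∷ t)  = cong (just true ∷_) (decode t)
    decode (just false ∷ t) = cong (just false ∷_) (decode t)

    map-positive : ∀ {m} (p q : Vec Bool m) → Vec.map positive (Vec.zipWith code p q) ≡ p
    map-positive []          []          = refl
    map-positive (true ∷ p)  (_ ∷ q)     = cong (true ∷_) (map-positive p q)
    map-positive (false ∷ p) (true ∷ q)  = cong (false ∷_) (map-positive p q)
    map-positive (false ∷ p) (false ∷ q) = cong (false ∷_) (map-positive p q)

    map-negative : ∀ {m} (p q : Vec Bool m) → (∀ i → lookup p i ≡ true → lookup q i ≡ true → ⊥) →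
      Vec.map negative (Vec.zipWith code p q) ≡ q
    map-negative []          []          _ = refl
    map-negative (true ∷ p)  (true ∷ q)  disjoint = ⊥-elim (disjoint zero refl refl)
    map-negative (true ∷ p)  (false ∷ q) disjoint = cong (false ∷_) (map-negative p q (disjoint ∘ suc))
    map-negative (false ∷ p) (true ∷ q)  disjoint = cong (true ∷_) (map-negative p q (disjoint ∘ suc))
    map-negative (false ∷ p) (false ∷ q) disjoint = cong (false ∷_) (map-negative p q (disjoint ∘ suc))

  fromSet-toSet : ∀ t → fromSet (toSet t) ≡ t
  fromSet-toSet t = trans (cong₂ (Vec.zipWith code) (take-++ (Vec.map positive t) _)
    (trans (cong (Vec.take n) (drop-++ (Vec.map positive t) _)) (take-++ (Vec.map negative t) []))) (decode t)

  toSet-injective : ∀ {t t′} → toSet t ≡ toSet t′ → t ≡ t′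
  toSet-injective {t} {t′} eq = trans (sym (fromSet-toSet t)) (trans (cong fromSet eq) (fromSet-toSet t′))

  private
    split : ∀ (S : Subset N) → Vec.take n S Vec.++ (Vec.take n (Vec.drop n S) Vec.++ []) ≡ S
    split S = trans (cong (Vec.take n S Vec.++_) (trans (cong (Vec.take n (Vec.drop n S) Vec.++_) (empty _))
      (take++drop≡id n (Vec.drop n S)))) (take++drop≡id n S)
      where
      empty : (p : Vec Bool 0) → [] ≡ p
      empty [] = refl

    lookup-left : ∀ (p q : Vec Bool n) i → lookup (p Vec.++ (q Vec.++ [])) (combine {2} zero i) ≡ lookup p i
    lookup-left p q i = lookup-++ˡ p _ i

    lookup-right : ∀ (p q : Vec Bool n) i → lookup (p Vec.++ (q Vec.++ [])) (combine {2} (suc zero) i) ≡ lookup q i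
    lookup-right p q i = trans (lookup-++ʳ p _ _) (lookup-++ˡ q [] i)

    adj-combine : ∀ i → Graph.Adj (M n) (combine {2} zero i) (combine {2} (suc zero) i)
    adj-combine i = (λ eq → distinct-halves (trans (sym (remQuot-combine {2} zero i)) (trans (cong (remQuot n) eq) (remQuot-combine {2} (suc zero) i)))) ,
      trans (cong proj₂ (remQuot-combine {2} zero i)) (sym (cong proj₂ (remQuot-combine {2} (suc zero) i)))
      where
      distinct-halves : (Fin.zero {1} , i) ≢ (suc zero , i)
      distinct-halves ()

  toSet-fromSet : ∀ {S} → Independent (M n) S → toSet (fromSet S) ≡ S
  toSet-fromSet {S} indep = trans
    (cong₂ (λ p q → p Vec.++ (q Vec.++ [])) (map-positive p q) (map-negative p q disjoint)) (split S)
    where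
    p q : Vec Bool n
    p = Vec.take n S
    q = Vec.take n (Vec.drop n S)
    disjoint : ∀ i → lookup p i ≡ true → lookup q i ≡ true → ⊥
    disjoint i pi qi = indep
      (lookup⇒[]= (combine {2} zero i) S (trans (cong (λ S → lookup S (combine {2} zero i)) (sym (split S))) (trans (lookup-left p q i) pi)))
      (lookup⇒[]= (combine {2} (suc zero) i) S (trans (cong (λ S → lookup S (combine {2} (suc zero) i)) (sym (split S))) (trans (lookup-right p q i) qi)))
      (adj-combine i)

  private
    not-both : ∀ t i → combine {2} zero i ∈ toSet t → combine {2} (suc zero) i ∉ toSet t
    not-both t i u∈ w∈ = conflict (lookup t i)
      (trans (sym (Vec.lookup-map i positive t))
        (trans (sym (lookup-left (Vec.map positive t) (Vec.map negative t) i)) ([]=⇒lookup u∈)))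
      (trans (sym (Vec.lookup-map i negative t))
        (trans (sym (lookup-right (Vec.map positive t) (Vec.map negative t) i)) ([]=⇒lookup w∈)))
      where
      conflict : ∀ x → positive x ≡ true → negative x ≡ true → ⊥
      conflict (just true) _ ()

  toSet-independent : ∀ t → Independent (M n) (toSet t)
  toSet-independent t {u} {w} u∈ w∈ (u≢w , eq)
    with combine-surjective {2} {n} u | combine-surjective {2} {n} w
  ... | a , i , refl | b , j , refl
    with trans (sym (cong proj₂ (remQuot-combine a i))) (trans eq (cong proj₂ (remQuot-combine b j)))
  ...   | refl with a | b
  ...     | zero     | zero     = u≢w refl
  ...     | suc zero | suc zero = u≢w refl
  ...     | zero     | suc zero = not-both t i u∈ w∈
  ...     | suc zero | zero     = not-both t i w∈ u∈

  independent-≤n : ∀ S → Independent (M n) S → ∣ S ∣ ≤ n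
  independent-≤n S indep = begin
    ∣ S ∣                  ≡⟨ cong ∣_∣ (toSet-fromSet indep) ⟨
    ∣ toSet (fromSet S) ∣  ≡⟨ ∣toSet∣ (fromSet S) ⟩
    support (fromSet S)    ≤⟨ support≤ (fromSet S) ⟩
    n                      ∎
    where open ≤-Reasoning

  independence-number : IndependenceNumber (M n) n
  independence-number = (toSet full , toSet-independent full , trans (∣toSet∣ full) (support-full n)) , independent-≤n
    where
    full : SignVec n
    full = Vec.replicate n (just true)
    support-full : ∀ m → support (Vec.replicate m (just true)) ≡ m
    support-full zero    = refl
    support-full (suc m) = cong suc (support-full m)

  n≤independenceNumber : ∀ {a} → IndependenceNumber (M n) a → n ≤ a
  n≤independenceNumber {a} (_ , max) with (S , indep , ∣S∣≡n) , _ ← independence-number = subst (_≤ a) ∣S∣≡n (max S indep)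

  -- A maximum independent set inside A has at least n ≥ r elements, so it is all of A.
  𝓟⇒independent : ∀ {r A} → r ≤ n → 𝓟^ (M n) r A → Independent (M n) A
  𝓟⇒independent r≤n (inj₁ indep , _) = indep
  𝓟⇒independent {A = A} r≤n (inj₂ (a , num , S , S⊆A , indep , ∣S∣≡a) , ∣A∣≡r) =
    subst (Independent (M n)) (⊆∧≡⇒≡ S⊆A (begin
      ∣ A ∣ ≡⟨ ∣A∣≡r ⟩
      _     ≤⟨ r≤n ⟩
      n     ≤⟨ n≤independenceNumber num ⟩
      a     ≡⟨ ∣S∣≡a ⟨
      ∣ S ∣ ∎)) indep
    where open ≤-Reasoning

  -- If an edge u w lay in the complement, u could be added to the maximum independent set S inside
  -- A: its only neighbour w is outside S, so an independent set with more than n elements would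
  -- result.
  𝓟⇒∁-independent : ∀ {r A} → n < r → 𝓟^ (M n) r A → Independent (M n) (∁ A)
  𝓟⇒∁-independent n<r (inj₁ indep , ∣A∣≡r) = contradiction (independent-≤n _ indep) (<⇒≱ (subst (n <_) (sym ∣A∣≡r) n<r))
  𝓟⇒∁-independent {A = A} n<r (inj₂ (a , num , S , S⊆A , indep , ∣S∣≡a) , ∣A∣≡r) {u} {w} u∈ w∈ adj =
    <⇒≱ (s≤s (n≤independenceNumber num)) (≤-trans (≤-reflexive larger) (independent-≤n (⁅ u ⁆ ∪ S) indep′))
    where
    u∉S : u ∉ S
    u∉S = x∈∁p⇒x∉p u∈ ∘ S⊆A
    w∉S : w ∉ S
    w∉S = x∈∁p⇒x∉p w∈ ∘ S⊆A
    larger : suc a ≡ ∣ ⁅ u ⁆ ∪ S ∣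
    larger = sym (trans (∣⁅x⁆∪p∣ u∉S) (cong suc ∣S∣≡a))
    unadjacent : ∀ {y} → y ∈ S → ¬ Graph.Adj (M n) u y
    unadjacent y∈ adj′ = w∉S (subst (_∈ S) (trans (adj⇒anti adj′) (sym (adj⇒anti adj))) y∈)
    indep′ : Independent (M n) (⁅ u ⁆ ∪ S)
    indep′ {x} {y} x∈ y∈ adj′ with x∈p∪q⁻ ⁅ u ⁆ S x∈ | x∈p∪q⁻ ⁅ u ⁆ S y∈
    ... | inj₂ x∈S | inj₂ y∈S = indep x∈S y∈S adj′
    ... | inj₁ x∈u | inj₂ y∈S = unadjacent y∈S (subst (λ z → Graph.Adj (M n) z y) (x∈⁅y⁆⇒x≡y u x∈u) adj′)
    ... | inj₂ x∈S | inj₁ y∈u = unadjacent x∈S (Graph.Adj-sym (M n) (subst (Graph.Adj (M n) x) (x∈⁅y⁆⇒x≡y u y∈u) adj′))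
    ... | inj₁ x∈u | inj₁ y∈u = Graph.Adj-irrefl (M n) (trans (x∈⁅y⁆⇒x≡y u x∈u) (sym (x∈⁅y⁆⇒x≡y u y∈u))) adj′

  -- For r > n the first n places of the arc form a maximum independent set.
  arc∈𝓟 : ∀ {v} → Arrangement v → ∀ j {r} → r ≤ N → 𝓟^ (M n) r (arc v j r)
  arc∈𝓟 {v} arr j {r} r≤N = 𝓟-arc , ∣arc∣ arr j r≤N
    where
    𝓟-arc : 𝓟 (M n) (arc v j r)
    𝓟-arc with r ≤? n
    ... | yes r≤n = inj₁ (arc-independent arr j r≤n)
    ... | no r≰n  = inj₂ (n , independence-number , arc v j n , initial , arc-independent arr j ≤-refl ,
                          ∣arc∣ arr j (m≤m+n n _))
      where
      initial : arc v j n ⊆ arc v j r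
      initial u∈ with i , i<n , refl ← ∈-arc⁻ v j n u∈ = ∈-arc⁺ v j (<-trans i<n (≰⇒> r≰n))

  layer : ℕ → Family N
  layer r with r ≤? n
  ... | yes _ = map toSet (signVecs n r)
  ... | no _  = map (∁ ∘ toSet) (signVecs n (N ∸ r))

  private
    ∁∘toSet-injective : ∀ {t t′} → ∁ (toSet t) ≡ ∁ (toSet t′) → t ≡ t′
    ∁∘toSet-injective eq = toSet-injective (trans (sym (∁-involutive _)) (trans (cong ∁ eq) (∁-involutive _)))

  layer-unique : ∀ r → Unique (layer r)
  layer-unique r with r ≤? n
  ... | yes _ = Unique.map⁺ toSet-injective (signVecs-unique n r)
  ... | no _  = Unique.map⁺ ∁∘toSet-injective (signVecs-unique n (N ∸ r))

  ∈-signVecs-fromSet : ∀ {S s} → Independent (M n) S → ∣ S ∣ ≡ s → fromSet S ∈ₗ signVecs n s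
  ∈-signVecs-fromSet {S} indep refl = subst (λ s → fromSet S ∈ₗ signVecs n s)
    (trans (sym (∣toSet∣ (fromSet S))) (cong ∣_∣ (toSet-fromSet indep))) (∈-signVecs (fromSet S))

  ∈-layer⁺ : ∀ {r A} → 𝓟^ (M n) r A → A ∈ₗ layer r
  ∈-layer⁺ {r} {A} A∈𝓟 with r ≤? n
  ... | yes r≤n = subst (_∈ₗ map toSet (signVecs n r)) (toSet-fromSet indep)
                    (∈-map⁺ toSet (∈-signVecs-fromSet indep (proj₂ A∈𝓟)))
    where indep = 𝓟⇒independent r≤n A∈𝓟
  ... | no r≰n  = subst (_∈ₗ map (∁ ∘ toSet) (signVecs n (N ∸ r))) (trans (cong ∁ (toSet-fromSet indep)) (∁-involutive A))
                    (∈-map⁺ (∁ ∘ toSet) (∈-signVecs-fromSet indep (trans (∣∁p∣≡n∸∣p∣ A) (cong (N ∸_) (proj₂ A∈𝓟)))))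
    where indep = 𝓟⇒∁-independent (≰⇒> r≰n) A∈𝓟

  LowOrHigh : ℕ → Subset N → Set
  LowOrHigh r A = (r ≤ n × Independent (M n) A) ⊎ (n < r × Independent (M n) (∁ A))

  𝓟⇒lowOrHigh : ∀ {r A} → 𝓟^ (M n) r A → LowOrHigh r A
  𝓟⇒lowOrHigh {r} A∈𝓟 with r ≤? n
  ... | yes r≤n = inj₁ (r≤n , λ {u} {w} → 𝓟⇒independent r≤n A∈𝓟 {u} {w})
  ... | no r≰n  = inj₂ (≰⇒> r≰n , λ {u} {w} → 𝓟⇒∁-independent (≰⇒> r≰n) A∈𝓟 {u} {w})

  ∈-layer⁻ : ∀ {r A} → r ≤ N → A ∈ₗ layer r → LowOrHigh r A × ∣ A ∣ ≡ r
  ∈-layer⁻ {r} r≤N A∈ with r ≤? n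
  ... | yes r≤n with t , t∈ , refl ← ∈-map⁻ toSet A∈ =
    inj₁ (r≤n , λ {u} {w} → toSet-independent t {u} {w}) , trans (∣toSet∣ t) (signVecs-support n r t∈)
  ... | no r≰n with t , t∈ , refl ← ∈-map⁻ (∁ ∘ toSet) A∈ =
    inj₂ (≰⇒> r≰n , subst (Independent (M n)) (sym (∁-involutive (toSet t))) (toSet-independent t)) ,
    trans (∣∁p∣≡n∸∣p∣ (toSet t)) (trans (cong (N ∸_) (trans (∣toSet∣ t) (signVecs-support n (N ∸ r) t∈))) (m∸[m∸n]≡n r≤N))

  length-layer-low : ∀ {r} → r ≤ n → length (layer r) ≡ 2 ^ r * (n C r)
  length-layer-low {r} r≤n with r ≤? n
  ... | yes _  = trans (length-map toSet (signVecs n r)) (length-signVecs n r)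
  ... | no r≰n = contradiction r≤n r≰n

  length-layer-high : ∀ {r s} → n < r → r + s ≡ N → length (layer r) ≡ 2 ^ s * (n C s)
  length-layer-high {r} {s} n<r r+s≡N with r ≤? n
  ... | yes r≤n = contradiction r≤n (<⇒≱ n<r)
  ... | no _    = trans (length-map (∁ ∘ toSet) (signVecs n (N ∸ r))) (trans (length-signVecs n (N ∸ r))
    (cong (λ s → 2 ^ s * (n C s)) (trans (cong (_∸ r) (sym r+s≡N)) (m+n∸m≡n r s))))

-- The bound as the size of a star.

bound-low : ∀ {n r} → r ≤ n → bound n r ≡ 2 ^ (r ∸ 1) * ((n ∸ 1) C (r ∸ 1))
bound-low {n} {r} r≤n rewrite dec-true (r ≤? n) r≤n = refl

bound-high : ∀ {n r s} → n < r → r + s ≡ 2 * n →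
  bound n r ≡ 2 ^ s * ((n ∸ 1) C s) + 2 ^ (s ∸ 1) * ((n ∸ 1) C (s ∸ 1))
bound-high {n} {r} {s} n<r r+s≡N rewrite dec-false (r ≤? n) (<⇒≱ n<r) =
  cong (λ s → 2 ^ s * ((n ∸ 1) C s) + 2 ^ (s ∸ 1) * ((n ∸ 1) C (s ∸ 1)))
    (trans (cong (_∸ r) (sym r+s≡N)) (m+n∸m≡n r s))

-- Incidences between vertices and members of 𝓟^r, counted in two ways: each member has `suc r`
-- vertices, and each of the `2 * suc m` stars has the size given by the bound.
star-identity-low : ∀ m r → suc r * (2 ^ suc r * (suc m C suc r)) ≡ 2 ^ r * (m C r) * (2 * suc m)
star-identity-low m r = begin
  suc r * (2 * 2 ^ r * (suc m C suc r))
    ≡⟨ solve 3 (λ r p c → r :* (con 2 :* p :* c) := con 2 :* p :* (r :* c)) refl (suc r) (2 ^ r) (suc m C suc r) ⟩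
  2 * 2 ^ r * (suc r * (suc m C suc r))
    ≡⟨ cong (2 * 2 ^ r *_) ([k+1]*[n+1]C[k+1] m r) ⟩
  2 * 2 ^ r * (suc m * (m C r))
    ≡⟨ solve 3 (λ n p c → con 2 :* p :* (n :* c) := p :* c :* (con 2 :* n)) refl (suc m) (2 ^ r) (m C r) ⟩
  2 ^ r * (m C r) * (2 * suc m) ∎
  where
  open ≡-Reasoning
  open +-*-Solver

-- The same incidence count above n. The two terms of the bound count complements that miss the edge
-- of x and complements that contain the antipode of x. Adding `suc s` copies of the layer to both
-- sides turns r into 2n, after which Pascal's rule and absorption suffice.
star-identity-high : ∀ m r s → r + suc s ≡ 2 * suc m →
  r * (2 ^ suc s * (suc m C suc s)) ≡ (2 ^ suc s * (m C suc s) + 2 ^ s * (m C s)) * (2 * suc m)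
star-identity-high m r s r+s≡N = +-cancelʳ-≡ (suc s * (2 * p * c)) _ _ (begin
  r * (2 * p * c) + suc s * (2 * p * c)
    ≡⟨ *-distribʳ-+ (2 * p * c) r (suc s) ⟨
  (r + suc s) * (2 * p * c)
    ≡⟨ cong₂ (λ N c → N * (2 * p * c)) r+s≡N (sym (nCk+nC[k+1]≡[n+1]C[k+1] m s)) ⟩
  2 * suc m * (2 * p * (y + x))
    ≡⟨ solve 4 (λ n p x y → con 2 :* n :* (con 2 :* p :* (y :+ x)) :=
         (con 2 :* p :* x :+ p :* y) :* (con 2 :* n) :+ con 2 :* p :* (n :* y)) refl (suc m) p x y ⟩
  (2 * p * x + p * y) * (2 * suc m) + 2 * p * (suc m * y)
    ≡⟨ cong (λ z → (2 * p * x + p * y) * (2 * suc m) + 2 * p * z) ([k+1]*[n+1]C[k+1] m s) ⟨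
  (2 * p * x + p * y) * (2 * suc m) + 2 * p * (suc s * c)
    ≡⟨ cong ((2 * p * x + p * y) * (2 * suc m) +_)
         (solve 3 (λ s p c → con 2 :* p :* (s :* c) := s :* (con 2 :* p :* c)) refl (suc s) p c) ⟩
  (2 * p * x + p * y) * (2 * suc m) + suc s * (2 * p * c) ∎)
  where
  open ≡-Reasoning
  open +-*-Solver
  p c x y : ℕ
  p = 2 ^ s
  c = suc m C suc s
  x = m C suc s
  y = m C s

r*layer≡bound*N : ∀ n r s → 1 ≤ n → 1 ≤ r → 1 ≤ s → r + s ≡ 2 * n →
  r * length (Layers.layer n r) ≡ bound n r * (2 * n)
r*layer≡bound*N (suc m) r@(suc r′) (suc s) _ _ _ r+s≡N with ≤-<-connex r (suc m)
... | inj₁ r≤n = trans (cong (r *_) (Layers.length-layer-low (suc m) r≤n))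
  (trans (star-identity-low m r′) (cong (_* (2 * suc m)) (sym (bound-low r≤n))))
... | inj₂ n<r = trans (cong (r *_) (Layers.length-layer-high (suc m) n<r r+s≡N))
  (trans (star-identity-high m r s r+s≡N) (cong (_* (2 * suc m)) (sym (bound-high n<r r+s≡N))))

nonempty : ∀ {m} {A : Subset m} → 1 ≤ ∣ A ∣ → ∃[ x ] x ∈ A
nonempty {m} {A} 1≤∣A∣ with nonempty? A
... | yes x∈A  = x∈A
... | no empty = contradiction (trans (cong ∣_∣ (Empty-unique empty)) (∣⊥∣≡0 m)) (>⇒≢ 1≤∣A∣)

-- The bound and the case of equality

module Realise (n : ℕ) (d : Fin (2 * n)) (r s : ℕ) (r+s≡N : r + s ≡ 2 * n) where
  open Antipode n
  open Words n d
  open Counting n d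
  open Layers n

  r≤N : r ≤ N
  r≤N = subst (r ≤_) r+s≡N (m≤m+n r s)

  ∉-window : ∀ {v} → Arrangement v → ∀ p j → 1 ≤ j → j ≤ s → v p ∉ arc v (p + j) r
  ∉-window arr p j 1≤j j≤s =
    ∉-arc arr p j 1≤j (≤-trans (+-monoˡ-≤ r j≤s) (≤-reflexive (trans (+-comm s r) r+s≡N)))

  ∈-window : ∀ {v} → Arrangement v → ∀ p j → s < j → j ≤ N → v p ∈ arc v (p + j) r
  ∈-window {v} arr p j s<j j≤N = subst (_∈ arc v (p + j) r)
    (trans (cong v (trans (+-assoc p j (N ∸ j)) (cong (p +_) (m+[n∸m]≡n j≤N)))) (periodic arr p))
    (∈-arc⁺ v (p + j) (+-cancelˡ-< j _ _ (begin-strict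
      j + (N ∸ j) ≡⟨ m+[n∸m]≡n j≤N ⟩
      N           ≡⟨ r+s≡N ⟨
      r + s       <⟨ +-monoʳ-< r s<j ⟩
      r + j       ≡⟨ +-comm r j ⟩
      j + r       ∎)))
    where open ≤-Reasoning

  through : V → (ℕ → V) → ℕ → ℕ
  through x v j = ⟦ does (x ∈? arc v j r) ⟧

  Σ-through : ∀ {v} → Arrangement v → ∀ x → Σ< N (through x v) ≡ r
  Σ-through {v} arr x = at-position (surjective arr x)
    where
    at-position : (∃[ p ] p < N × x ≡ v p) → Σ< N (through x v) ≡ r
    at-position (p , _ , refl) = begin
      Σ< N f
        ≡⟨ Σ<-rotate N f (λ j → cong (λ A → ⟦ does (v p ∈? A) ⟧) (arc-periodic arr j r)) (suc p) ⟨
      Σ< N (λ i → f (suc p + i))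
        ≡⟨ cong (λ m → Σ< m (λ i → f (suc p + i))) (trans (+-comm s r) r+s≡N) ⟨
      Σ< (s + r) (λ i → f (suc p + i))
        ≡⟨ Σ<-split s r (λ i → f (suc p + i)) ⟩
      Σ< s (λ i → f (suc p + i)) + Σ< r (λ i → f (suc p + (s + i)))
        ≡⟨ cong₂ _+_ (Σ<-cong s outside) (Σ<-cong r inside) ⟩
      Σ< s (λ _ → 0) + Σ< r (λ _ → 1)
        ≡⟨ cong₂ _+_ (trans (Σ<-const s 0) (*-zeroʳ s)) (trans (Σ<-const r 1) (*-identityʳ r)) ⟩
      r ∎
      where
      open ≡-Reasoning
      f : ℕ → ℕ
      f = through (v p) v
      outside : ∀ i → i < s → f (suc p + i) ≡ 0
      outside i i<s = cong ⟦_⟧ (dec-false (v p ∈? arc v (suc p + i) r)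
        (subst (λ j → v p ∉ arc v j r) (+-suc p i) (∉-window arr p (suc i) (s≤s z≤n) i<s)))
      inside : ∀ i → i < r → f (suc p + (s + i)) ≡ 1
      inside i i<r = cong ⟦_⟧ (dec-true (v p ∈? arc v (suc p + (s + i)) r)
        (subst (λ j → v p ∈ arc v j r) (+-suc p (s + i))
          (∈-window arr p (suc (s + i)) (s≤s (m≤m+n s i))
            (≤-trans (+-monoʳ-< s i<r) (≤-reflexive (trans (+-comm s r) r+s≡N))))))

  -- Every vertex occurs somewhere on the standard cycle, and a shift brings it to the front with
  -- the right sign.
  valid-from : ∀ x → ∃[ w ] Valid (x ∷ w)
  valid-from x = from-word (valid-∷ standard-valid) standard-valid
    where
    from-word : ∀ {u} → (∃[ y ] ∃[ w ] u ≡ y ∷ w) → Valid u → ∃[ w ] Valid (x ∷ w)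
    from-word (y , w , refl) valid with surjective (cyc-arrangement valid) x
    ... | p , _ , x≡ with z , w′ , valid′ , eq ← valid-shift p y w valid =
      w′ , subst (λ z → Valid (z ∷ w′)) (trans (sym (eq 0)) (trans (cong (cyc (y ∷ w)) (+-identityʳ p)) (sym x≡))) valid′

  -- The sets that `arrange` can turn into arcs with x at position 0: directly for r ≤ n, and
  -- through the complementary arc for r > n, where it is the independent complement that has to
  -- contain x.
  Pointed : V → Subset N → Set
  Pointed x A = (r ≤ n × Independent (M n) A × x ∈ A) ⊎ (n < r × Independent (M n) (∁ A) × x ∉ A)

  arrange-pointed : ∀ {x w A} → Valid (x ∷ w) → ∣ A ∣ ≡ r → Pointed x A →
    ∃[ w′ ] w ↭ w′ × ∃[ j ] arc (cyc (x ∷ w′)) j r ≡ A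
  arrange-pointed valid refl (inj₁ (_ , indep , x∈A)) = arrange valid indep x∈A
  arrange-pointed {x} {w} {A} valid ∣A∣≡r (inj₂ (_ , indep , x∉A)) = complement (arrange valid indep (x∉p⇒x∈∁p x∉A))
    where
    ∣∁A∣≡s : ∣ ∁ A ∣ ≡ s
    ∣∁A∣≡s = trans (∣∁p∣≡n∸∣p∣ A) (trans (cong₂ _∸_ (sym r+s≡N) ∣A∣≡r) (m+n∸m≡n r s))
    complement : (∃[ w′ ] w ↭ w′ × ∃[ j ] arc (cyc (x ∷ w′)) j ∣ ∁ A ∣ ≡ ∁ A) →
      ∃[ w′ ] w ↭ w′ × ∃[ j ] arc (cyc (x ∷ w′)) j r ≡ A
    complement (w′ , p , j , eq) = w′ , p , j + s , (begin
      arc v (j + s) r         ≡⟨ ∁-arc (cyc-arrangement (valid-↭ (prep x p) valid)) j {r} {s} r+s≡N ⟨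
      ∁ (arc v j s)           ≡⟨ cong (λ ℓ → ∁ (arc v j ℓ)) ∣∁A∣≡s ⟨
      ∁ (arc v j ∣ ∁ A ∣)     ≡⟨ cong ∁ eq ⟩
      ∁ (∁ A)                 ≡⟨ ∁-involutive A ⟩
      A                       ∎)
      where
      open ≡-Reasoning
      v : ℕ → V
      v = cyc (x ∷ w′)

  pointed : ∀ {A} → 1 ≤ r → 1 ≤ s → LowOrHigh r A → ∣ A ∣ ≡ r → ∃[ x ] Pointed x A
  pointed {A} 1≤r 1≤s (inj₁ (r≤n , indep)) ∣A∣≡r with x , x∈A ← nonempty (subst (1 ≤_) (sym ∣A∣≡r) 1≤r) =
    x , inj₁ (r≤n , (λ {u} {w} → indep {u} {w}) , x∈A)
  pointed {A} 1≤r 1≤s (inj₂ (n<r , indep)) ∣A∣≡r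
    with x , x∈∁A ← nonempty {A = ∁ A} (subst (1 ≤_) (sym (trans (∣∁p∣≡n∸∣p∣ A)
                      (trans (cong₂ _∸_ (sym r+s≡N) ∣A∣≡r) (m+n∸m≡n r s)))) 1≤s) =
    x , inj₂ (n<r , (λ {u} {w} → indep {u} {w}) , x∈∁p⇒x∉p x∈∁A)

  realise : 1 ≤ r → 1 ≤ s → ∀ {A} → LowOrHigh r A → ∣ A ∣ ≡ r → ∃[ w ] Valid w × arc (cyc w) 0 r ≡ A
  realise 1≤r 1≤s {A} cases ∣A∣≡r = at-start (pointed 1≤r 1≤s cases ∣A∣≡r)
    where
    at-start : (∃[ x ] Pointed x A) → ∃[ w ] Valid w × arc (cyc w) 0 r ≡ A
    at-start (x , point) with w , valid ← valid-from x
                         with w′ , p , j , eq ← arrange-pointed valid ∣A∣≡r point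
                         with y , w″ , valid′ , eqs ← valid-shift j x w′ (valid-↭ (prep x p) valid) =
      y ∷ w″ , valid′ , trans (sym (arc-cong (cyc (x ∷ w′)) (cyc (y ∷ w″)) j 0 r eqs)) eq

  module _ (1≤n : 1 ≤ n) (1≤r : 1 ≤ r) (1≤s : 1 ≤ s) where

    -- The common number of occurrences of the members of 𝓟^r as arcs. It is never evaluated: being
    -- nonzero, it cancels.
    weight : ℕ
    weight = occurrences r (arc (cyc standard) 0 r)

    occurrences≡weight : ∀ {A} → LowOrHigh r A → ∣ A ∣ ≡ r → occurrences r A ≡ weight
    occurrences≡weight {A} cases ∣A∣≡r = at-start (realise 1≤r 1≤s cases ∣A∣≡r)
      where
      at-start : (∃[ w ] Valid w × arc (cyc w) 0 r ≡ A) → occurrences r A ≡ weight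
      at-start (w , valid , eq) = trans (cong (occurrences r) (sym eq)) (occurrences-const r {w} {standard} valid standard-valid)

    ∑-weight : ∀ {G : Family N} → Unique G → (∀ {A} → A ∈ᶠ G → LowOrHigh r A × ∣ A ∣ ≡ r) →
      ∑ arrangements (λ w → Σ< N (λ j → ⟦ does (arc (cyc w) j r ∈ᶠ? G) ⟧)) ≡ length G * weight
    ∑-weight {G} uG cases = trans (double-count r uG)
      (trans (∑-cong G λ A∈ → occurrences≡weight (proj₁ (cases A∈)) (proj₂ (cases A∈))) (∑-const G weight))

    arrangements*N : length arrangements * N ≡ length (layer r) * weight
    arrangements*N = begin
      length arrangements * N
        ≡⟨ ∑-const arrangements N ⟨
      ∑ arrangements (λ _ → N)
        ≡⟨ ∑-cong arrangements (λ {w} w∈ → sym (trans (Σ<-cong N λ j _ → cong ⟦_⟧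
             (dec-true (arc (cyc w) j r ∈ᶠ? layer r) (∈-layer⁺ (arc∈𝓟 (valid⇒arrangement (∈-arrangements⁻ w∈)) j r≤N))))
             (trans (Σ<-const N 1) (*-identityʳ N)))) ⟩
      ∑ arrangements (λ w → Σ< N (λ j → ⟦ does (arc (cyc w) j r ∈ᶠ? layer r) ⟧))
        ≡⟨ ∑-weight (layer-unique r) (∈-layer⁻ r≤N) ⟩
      length (layer r) * weight ∎
      where open ≡-Reasoning

    -- This is `arrangements*N` scaled by r / N, with the layer traded for the bound; multiplying
    -- through by N avoids the division.
    arrangements*r : length arrangements * r ≡ bound n r * weight
    arrangements*r = *-cancelʳ-≡ _ _ N (begin
      length arrangements * r * N
        ≡⟨ rotate-* (length arrangements) r N ⟩
      r * (length arrangements * N)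
        ≡⟨ cong (r *_) arrangements*N ⟩
      r * (length (layer r) * weight)
        ≡⟨ *-assoc r (length (layer r)) weight ⟨
      r * length (layer r) * weight
        ≡⟨ cong (_* weight) (r*layer≡bound*N n r s 1≤n 1≤r 1≤s r+s≡N) ⟩
      bound n r * N * weight
        ≡⟨ swap-* (bound n r) N weight ⟩
      bound n r * weight * N ∎)
      where
      open ≡-Reasoning
      rotate-* : ∀ a b c → a * b * c ≡ b * (a * c)
      rotate-* a b c = trans (cong (_* c) (*-comm a b)) (*-assoc b a c)
      swap-* : ∀ a b c → a * b * c ≡ a * c * b
      swap-* a b c = trans (*-assoc a b c) (trans (cong (a *_) (*-comm b c)) (sym (*-assoc a c b)))

    -- A zero weight would leave no arrangement, but `standard` is one.
    weight≢0 : NonZero weight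
    weight≢0 = ≢-nonZero λ weight≡0 → m*n≢0⇒ (trans arrangements*r (trans (cong (bound n r *_) weight≡0) (*-zeroʳ (bound n r))))
      where
      m*n≢0⇒ : length arrangements * r ≢ 0
      m*n≢0⇒ eq = <⇒≢ (*-mono-≤ some 1≤r) (sym eq)
        where
        some : 1 ≤ length arrangements
        some = ∈-length (∈-arrangements⁺ standard-valid)

-- Averaging for an intersecting family, and recovery of the star.

module Extremal (n : ℕ) (d : Fin (2 * n)) (k′ r s t : ℕ) (r+s≡N : r + s ≡ 2 * n) (ks≡N+t : suc k′ * s ≡ 2 * n + t)
  (1≤n : 1 ≤ n) (1≤r : 1 ≤ r) (1≤s : 1 ≤ s)
  (F : Family (2 * n)) (uF : Unique F) (F⊆𝓟 : All (𝓟^ (M n) r) F) (intersecting : WiseIntersecting (suc k′) F) where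
  open Antipode n
  open Words n d
  open Counting n d
  open Layers n
  open Realise n d r s r+s≡N
  open Intersecting n k′ r s r+s≡N F intersecting

  private
    instance
      _ : NonZero (weight 1≤n 1≤r 1≤s)
      _ = weight≢0 1≤n 1≤r 1≤s
    ω : ℕ
    ω = weight 1≤n 1≤r 1≤s

  F-cases : ∀ {A} → A ∈ᶠ F → LowOrHigh r A × ∣ A ∣ ≡ r
  F-cases A∈F = 𝓟⇒lowOrHigh (All.lookup F⊆𝓟 A∈F) , proj₂ (All.lookup F⊆𝓟 A∈F)

  ∑-hits : ∑ arrangements (hits ∘ cyc) ≡ length F * ω
  ∑-hits = trans (∑-cong arrangements λ {w} _ → Σ<-cong N λ j _ → cong ⟦_⟧ (hit-does (cyc w) j))
    (∑-weight 1≤n 1≤r 1≤s uF F-cases)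

  hits≤ : ∀ {w} → w ∈ₗ arrangements → hits (cyc w) ≤ r
  hits≤ w∈ = hits≤r ks≡N+t (valid⇒arrangement (∈-arrangements⁻ w∈))

  length≤bound : length F ≤ bound n r
  length≤bound = *-cancelʳ-≤ _ _ ω (begin
    length F * ω                    ≡⟨ ∑-hits ⟨
    ∑ arrangements (hits ∘ cyc)     ≤⟨ ∑-mono arrangements hits≤ ⟩
    ∑ arrangements (λ _ → r)        ≡⟨ ∑-const arrangements r ⟩
    length arrangements * r         ≡⟨ arrangements*r 1≤n 1≤r 1≤s ⟩
    bound n r * ω                   ∎)
    where open ≤-Reasoning

  full⇒length≡bound : (∀ {w} → Valid w → hits (cyc w) ≡ r) → length F ≡ bound n r
  full⇒length≡bound full = *-cancelʳ-≡ _ _ ω (begin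
    length F * ω                    ≡⟨ ∑-hits ⟨
    ∑ arrangements (hits ∘ cyc)     ≡⟨ ∑-cong arrangements (full ∘ ∈-arrangements⁻) ⟩
    ∑ arrangements (λ _ → r)        ≡⟨ ∑-const arrangements r ⟩
    length arrangements * r         ≡⟨ arrangements*r 1≤n 1≤r 1≤s ⟩
    bound n r * ω                   ∎)
    where open ≡-Reasoning

  -- No arrangement exceeds r and the average attains it.
  length≡bound⇒full : length F ≡ bound n r → ∀ {w} → Valid w → hits (cyc w) ≡ r
  length≡bound⇒full eq valid = ∑-squeeze arrangements hits≤ (begin
    ∑ arrangements (hits ∘ cyc)     ≡⟨ ∑-hits ⟩
    length F * ω                    ≡⟨ cong (_* ω) eq ⟩
    bound n r * ω                   ≡⟨ arrangements*r 1≤n 1≤r 1≤s ⟨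
    length arrangements * r         ≡⟨ ∑-const arrangements r ⟨
    ∑ arrangements (λ _ → r)        ∎) (∈-arrangements⁺ valid)
    where open ≡-Reasoning

  star⇒full : ∀ x → (_∈ᶠ F) ≐ 𝓟^-at (M n) r x → ∀ {w} → Valid w → hits (cyc w) ≡ r
  star⇒full x (F⊆star , star⊆F) {w} valid = trans (Σ<-cong N same) (Σ-through arr x)
    where
    arr : Arrangement (cyc w)
    arr = valid⇒arrangement valid
    same : ∀ j → j < N → ⟦ hit (cyc w) j ⟧ ≡ through x (cyc w) j
    same j _ with x ∈? arc (cyc w) j r
    ... | yes x∈ = cong ⟦_⟧ (hit⁺ (cyc w) j (star⊆F (arc∈𝓟 arr j r≤N , x∈)))
    ... | no x∉  = cong ⟦_⟧ (trans (hit-does (cyc w) j)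
                     (dec-false (arc (cyc w) j r ∈ᶠ? F) (x∉ ∘ proj₂ ∘ F⊆star)))

  module _ (1≤t : 1 ≤ t) (full : ∀ {w} → Valid w → hits (cyc w) ≡ r) where

    private
      -- With t ≥ 1, the k arcs of length s have total length at least N + 1 = s + r + 1.
      strict : suc r ≤ k′ * s
      strict = +-cancelˡ-≤ s _ _ (begin
        s + suc r   ≡⟨ +-suc s r ⟩
        suc (s + r) ≡⟨ cong suc (trans (+-comm s r) r+s≡N) ⟩
        suc N       ≡⟨ +-comm 1 N ⟩
        N + 1       ≤⟨ +-monoʳ-≤ N 1≤t ⟩
        N + t       ≡⟨ ks≡N+t ⟨
        s + k′ * s  ∎)
        where open ≤-Reasoning

    centred-cong : ∀ {v v′} → (∀ i → v i ≡ v′ i) → Centred v → Centred v′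
    centred-cong {v} {v′} v≡v′ (empty , filled) =
      (λ j 1≤j j≤s → trans (sym (same j)) (empty j 1≤j j≤s)) ,
      (λ j s<j j≤N → trans (sym (same j)) (filled j s<j j≤N))
      where
      same : ∀ j → hit v j ≡ hit v′ j
      same j = hit-cong v j v′ j (arc-cong v v′ j j r λ i → v≡v′ (j + i))

    centre : ∃[ x ] ∃[ w ] Valid (x ∷ w) × Centred (cyc (x ∷ w))
    centre = from-word (valid-∷ standard-valid) standard-valid
      where
      from-word : ∀ {u} → (∃[ y ] ∃[ w ] u ≡ y ∷ w) → Valid u → ∃[ x ] ∃[ w ] Valid (x ∷ w) × Centred (cyc (x ∷ w))
      from-word (y , w , refl) valid = from-centre
        (centred ks≡N+t 1≤t 1≤r 1≤s {cyc (y ∷ w)} (cyc-arrangement valid) (full valid))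
        where
        from-centre : (∃[ p ] Centred (λ j → cyc (y ∷ w) (p + j))) → ∃[ x ] ∃[ w ] Valid (x ∷ w) × Centred (cyc (x ∷ w))
        from-centre (p , cen) with x , w′ , valid′ , eqs ← valid-shift p y w valid = x , w′ , valid′ , centred-cong eqs cen

    -- Letters already passed are collected in `pre`. Each swap thus takes place behind x, where
    -- `swap-centred` applies, and x stays at position 0.
    centred-↭ : ∀ x pre {w w′} → w ↭ w′ → Valid (x ∷ pre ++ w) → Centred (cyc (x ∷ pre ++ w)) → Centred (cyc (x ∷ pre ++ w′))
    centred-↭ x pre refl valid cen = cen
    centred-↭ x pre {w} {w′} (↭.trans p q) valid cen =
      centred-↭ x pre q (valid-↭ (++⁺ˡ (x ∷ pre) p) valid) (centred-↭ x pre p valid cen)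
    centred-↭ x pre {_ ∷ w} {_ ∷ w′} (prep a p) valid cen =
      subst (λ u → Centred (cyc (x ∷ u))) (++-assoc pre [ a ] w′)
        (centred-↭ x (pre ++ [ a ]) p (subst (λ u → Valid (x ∷ u)) (sym (++-assoc pre [ a ] w)) valid)
          (subst (λ u → Centred (cyc (x ∷ u))) (sym (++-assoc pre [ a ] w)) cen))
    centred-↭ x pre {_ ∷ _ ∷ w} {_ ∷ _ ∷ w′} (swap a b p) valid cen =
      subst (λ u → Centred (cyc (x ∷ u))) (++-assoc pre (b ∷ a ∷ []) w′)
        (centred-↭ x (pre ++ b ∷ a ∷ []) p (subst (λ u → Valid (x ∷ u)) (sym (++-assoc pre (b ∷ a ∷ []) w)) valid′)
          (subst (λ u → Centred (cyc (x ∷ u))) (sym (++-assoc pre (b ∷ a ∷ []) w)) cen′))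
      where
      valid′ : Valid (x ∷ pre ++ b ∷ a ∷ w)
      valid′ = valid-↭ (++⁺ˡ (x ∷ pre) (swap a b refl)) valid
      i+1<n : suc (length (x ∷ pre)) < n
      i+1<n = begin-strict
        suc (length (x ∷ pre))                ≤⟨ ≤-reflexive (+-comm 1 _) ⟩
        length (x ∷ pre) + 1                  <⟨ +-monoʳ-< (length (x ∷ pre)) (s≤s (s≤s z≤n)) ⟩
        length (x ∷ pre) + length (a ∷ b ∷ w) ≡⟨ length-++ (x ∷ pre) ⟨
        length (x ∷ pre ++ a ∷ b ∷ w)         ≡⟨ proj₁ valid ⟩
        n                                     ∎
        where open ≤-Reasoning
      cen′ : Centred (cyc (x ∷ pre ++ b ∷ a ∷ w))
      cen′ = swap-centred strict 1≤r (s≤s z≤n) i+1<n (cyc-arrangement valid) (cyc-arrangement valid′)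
        (cyc-swapped (x ∷ pre) a b w (proj₁ valid) (cyc-arrangement valid) (cyc-arrangement valid′)) (full valid′) cen

    centred⇒∈ : ∀ {v} → Arrangement v → Centred v → ∀ j → (v 0 ∈ arc v j r → arc v j r ∈ᶠ F) × (arc v j r ∈ᶠ F → v 0 ∈ arc v j r)
    centred⇒∈ {v} arr (empty , filled) j = at-residue residue
      where
      residue : ∃[ i ] 1 ≤ i × i ≤ N × arc v j r ≡ arc v i r
      residue with j % N | arc-mod arr j r | m%n<n j N
      -- `Centred` speaks of the positions 1 to N, so residue 0 is represented by N.
      ... | zero  | eq | _   = N , ≤-trans 1≤r r≤N , ≤-refl , trans eq (sym (arc-periodic arr 0 r))
      ... | suc i | eq | i<N = suc i , s≤s z≤n , <⇒≤ i<N , eq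
      at-residue : (∃[ i ] 1 ≤ i × i ≤ N × arc v j r ≡ arc v i r) →
        (v 0 ∈ arc v j r → arc v j r ∈ᶠ F) × (arc v j r ∈ᶠ F → v 0 ∈ arc v j r)
      at-residue (i , 1≤i , i≤N , eq) with i ≤? s
      ... | yes i≤s = (λ x∈ → contradiction (subst (v 0 ∈_) eq x∈) (∉-window arr 0 i 1≤i i≤s)) ,
                      (λ A∈ → ⊥-elim (true≢false (hit⁺ v i (subst (_∈ᶠ F) eq A∈)) (empty i 1≤i i≤s)))
      ... | no i≰s  = (λ _ → subst (_∈ᶠ F) (sym eq) (hit⁻ v i (filled i (≰⇒> i≰s) i≤N))) ,
                      (λ _ → subst (v 0 ∈_) (sym eq) (∈-window arr 0 i (≰⇒> i≰s) i≤N))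

    -- For r ≤ n such a set contains x, so it is forced into F; for r > n it avoids x, so it is kept
    -- out of F.
    determined : ∀ {x w} → Valid (x ∷ w) → Centred (cyc (x ∷ w)) → ∀ {A} → ∣ A ∣ ≡ r → Pointed x A →
      (x ∈ A → A ∈ᶠ F) × (A ∈ᶠ F → x ∈ A)
    determined {x} {w} valid cen {A} ∣A∣≡r point = from-word (arrange-pointed valid ∣A∣≡r point)
      where
      from-word : (∃[ w′ ] w ↭ w′ × ∃[ j ] arc (cyc (x ∷ w′)) j r ≡ A) → (x ∈ A → A ∈ᶠ F) × (A ∈ᶠ F → x ∈ A)
      from-word (w′ , p , j , eq) = subst (λ A → (x ∈ A → A ∈ᶠ F) × (A ∈ᶠ F → x ∈ A)) eq
        (centred⇒∈ (cyc-arrangement (valid-↭ (prep x p) valid)) (centred-↭ x [] p valid cen) j)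

    -- One inclusion between F and the star holds, and both have r members on every arrangement.
    hit≡through : ∀ {x w} → Valid (x ∷ w) → Centred (cyc (x ∷ w)) →
      ∀ {u} → Valid u → ∀ j → j < N → ⟦ hit (cyc u) j ⟧ ≡ through x (cyc u) j
    hit≡through {x} valid cen {u} valid-u with ≤-<-connex r n
    ... | inj₁ r≤n = λ j j<N → sym (Σ<-squeeze N le (trans (Σ-through arr x) (sym (full valid-u))) j j<N)
      where
      arr : Arrangement (cyc u)
      arr = valid⇒arrangement valid-u
      le : ∀ j → j < N → through x (cyc u) j ≤ ⟦ hit (cyc u) j ⟧
      le j _ with x ∈? arc (cyc u) j r
      ... | no _   = z≤n
      ... | yes x∈ = ≤-reflexive (sym (cong ⟦_⟧ (hit⁺ (cyc u) j
        (proj₁ (determined valid cen (∣arc∣ arr j r≤N) (inj₁ (r≤n , arc-independent arr j r≤n , x∈))) x∈))))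
    ... | inj₂ n<r = Σ<-squeeze N le (trans (full valid-u) (sym (Σ-through arr x)))
      where
      arr : Arrangement (cyc u)
      arr = valid⇒arrangement valid-u
      le : ∀ j → j < N → ⟦ hit (cyc u) j ⟧ ≤ through x (cyc u) j
      le j _ with x ∈? arc (cyc u) j r
      ... | yes _ = ⟦⟧≤1 (hit (cyc u) j)
      ... | no x∉ = ≤-reflexive (cong ⟦_⟧ (trans (hit-does (cyc u) j) (dec-false (arc (cyc u) j r ∈ᶠ? F) λ A∈F →
        x∉ (proj₂ (determined valid cen (∣arc∣ arr j r≤N)
          (inj₂ (n<r , 𝓟⇒∁-independent n<r (arc∈𝓟 arr j r≤N) , x∉))) A∈F))))

    -- By `realise` every member of 𝓟^r is the arc at position 0 of some valid word, so agreement of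
    -- F and the star on arcs is agreement everywhere.
    full⇒star : ∃[ x ] ((_∈ᶠ F) ≐ 𝓟^-at (M n) r x)
    full⇒star = from-centre centre
      where
      from-centre : (∃[ x ] ∃[ w ] Valid (x ∷ w) × Centred (cyc (x ∷ w))) → ∃[ x ] ((_∈ᶠ F) ≐ 𝓟^-at (M n) r x)
      from-centre (x , w , valid , cen) = x , F⊆star , star⊆F
        where
        0<N : 0 < N
        0<N = ≤-trans 1≤r r≤N
        F⊆star : ∀ {A} → A ∈ᶠ F → 𝓟^-at (M n) r x A
        F⊆star {A} A∈F = All.lookup F⊆𝓟 A∈F , through-A (realise 1≤r 1≤s (proj₁ (F-cases A∈F)) (proj₂ (F-cases A∈F)))
          where
          through-A : (∃[ u ] Valid u × arc (cyc u) 0 r ≡ A) → x ∈ A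
          through-A (u , valid-u , eq) = subst (x ∈_) eq (does⇒ (x ∈? arc (cyc u) 0 r) (⟦⟧-injective
            (trans (sym (hit≡through valid cen valid-u 0 0<N))
              (cong ⟦_⟧ (hit⁺ (cyc u) 0 (subst (_∈ᶠ F) (sym eq) A∈F))))))
        star⊆F : ∀ {A} → 𝓟^-at (M n) r x A → A ∈ᶠ F
        star⊆F {A} (A∈𝓟 , x∈A) = member (realise 1≤r 1≤s (𝓟⇒lowOrHigh A∈𝓟) (proj₂ A∈𝓟))
          where
          member : (∃[ u ] Valid u × arc (cyc u) 0 r ≡ A) → A ∈ᶠ F
          member (u , valid-u , eq) = subst (_∈ᶠ F) eq (hit⁻ (cyc u) 0 (⟦⟧-injective
            (trans (hit≡through valid cen valid-u 0 0<N)
              (cong ⟦_⟧ (dec-true (x ∈? arc (cyc u) 0 r) (subst (x ∈_) (sym eq) x∈A))))))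

  bound∧equality : length F ≤ bound n r ×
    (1 ≤ t → (length F ≡ bound n r) ⇔ (∃[ x ] ((_∈ᶠ F) ≐ 𝓟^-at (M n) r x)))
  bound∧equality = length≤bound , λ 1≤t → mk⇔
    (λ eq → full⇒star 1≤t (length≡bound⇒full eq))
    (λ (x , star) → full⇒length≡bound (star⇒full x star))

theorem1p3 : (n k r : ℕ) → 1 ≤ n → 2 ≤ k → 1 ≤ r →
    r * k ≤ (k ∸ 1) * (2 * n) →
    (F : Family (2 * n)) → Unique F →
    All (𝓟^ (M n) r) F →
    WiseIntersecting k F →
    length F ≤ bound n r
    × (r * k < (k ∸ 1) * (2 * n) →
    (length F ≡ bound n r) ⇔ (∃[ x ] ((_∈ᶠ F) ≐ 𝓟^-at (M n) r x)))
theorem1p3 n (suc k′) r 1≤n _ 1≤r rk≤k′N F uF F⊆𝓟 intersecting =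
  map₂ (λ equality strict → equality (1≤t strict))
    -- As n ≥ 1 there is a vertex to serve as the value of `cyc` on the empty word.
    (Extremal.bound∧equality n (combine {2} zero (fromℕ< 1≤n)) k′ r s t r+s≡N ks≡N+t 1≤n 1≤r 1≤s F uF F⊆𝓟 intersecting)
  where
  N s t : ℕ
  N = 2 * n
  s = N ∸ r
  t = suc k′ * s ∸ N
  r<N : r < N
  r<N = *-cancelʳ-< (suc k′) r N (begin-strict
    r * suc k′     ≤⟨ rk≤k′N ⟩
    k′ * N         <⟨ m<n+m (k′ * N) (≤-trans 1≤n (m≤m+n n _)) ⟩
    N + k′ * N     ≡⟨ *-comm (suc k′) N ⟩
    N * suc k′     ∎)
    where open ≤-Reasoning
  r+s≡N : r + s ≡ N
  r+s≡N = m+[n∸m]≡n (<⇒≤ r<N)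
  1≤s : 1 ≤ s
  1≤s = m<n⇒0<n∸m r<N
  -- As k r + k s = (k - 1) N + N, the inequality r k ≤ (k - 1) N is equivalent to N ≤ k s, and
  -- likewise for the strict versions.
  rk+ks : r * suc k′ + suc k′ * s ≡ k′ * N + N
  rk+ks = begin
    r * suc k′ + suc k′ * s ≡⟨ cong (_+ suc k′ * s) (*-comm r (suc k′)) ⟩
    suc k′ * r + suc k′ * s ≡⟨ *-distribˡ-+ (suc k′) r s ⟨
    suc k′ * (r + s)        ≡⟨ cong (suc k′ *_) r+s≡N ⟩
    N + k′ * N              ≡⟨ +-comm N (k′ * N) ⟩
    k′ * N + N              ∎
    where open ≡-Reasoning
  N≤ks : N ≤ suc k′ * s
  N≤ks = +-cancelˡ-≤ (k′ * N) _ _ (subst (_≤ k′ * N + suc k′ * s) rk+ks (+-monoˡ-≤ (suc k′ * s) rk≤k′N))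
  ks≡N+t : suc k′ * s ≡ N + t
  ks≡N+t = sym (m+[n∸m]≡n N≤ks)
  1≤t : r * suc k′ < k′ * N → 1 ≤ t
  1≤t strict = m<n⇒0<n∸m (+-cancelˡ-< (k′ * N) _ _
    (subst (_< k′ * N + suc k′ * s) rk+ks (+-monoˡ-< (suc k′ * s) strict)))
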